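{- Let $G$ be a connected graph of order $n$ and let $k$ be an integer such that $3\leq k\leq n$. Then $\lambda_k(G)=n-\lceil\frac{k}{2}\rceil$ if and only if the following holds: $G=K_n$ if $k$ is even; and $G=K_n\setminus M$ for some edge set $M\subseteq E(K_n)$ with $0\leq |M|\leq \frac{k-1}{2}$ if $k$ is odd.
   Context: All graphs are undirected, finite and simple. For a graph $G$ and a set $S\subseteq V(G)$ of at least two vertices, a tree connecting $S$ is a subgraph $T$ of $G$ that is a tree with $S\subseteq V(T)$. Let $\lambda(S)$ be the maximum number of pairwise edge-disjoint trees connecting $S$ in $G$. The generalized $k$-edge-connectivity of $G$ is $\lambda_k(G)=\min\{\lambda(S) : S\subseteq V(G),\ |S|=k\}$. $K_n$ is the complete graph of order $n$, and $K_n\setminus M$ is the graph obtained from $K_n$ by deleting the edges of $M$ (keeping all vertices). Equality of graphs is understood up to isomorphism. -}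

module Defs where

open import Data.Bool.Base using (Bool; false; not; _∧_; T)
open import Data.Bool.Properties using (∧-zeroˡ)
open import Data.Fin.Base using (Fin; toℕ)
open import Data.Fin.Permutation using (Permutation; _⟨$⟩ʳ_)
open import Data.Fin.Properties using (_≟_)
open import Data.Fin.Subset using (Subset; _∈_; _⊆_; ⊤; ∣_∣; Nonempty)
open import Data.List.Base using (List; []; _∷_; _++_; length; filterᵇ; allFin; cartesianProduct)
open import Data.List.Relation.Unary.Linked using (Linked)
open import Data.List.Relation.Unary.Unique.Propositional using (Unique)
open import Data.Nat.Base using (ℕ; _≤_; _<ᵇ_)
open import Data.Product.Base using (Σ-syntax; ∃-syntax; _×_; _,_)
open import Relation.Binary.Construct.Closure.ReflexiveTransitive using (Star)
open import Relation.Binary.PropositionalEquality using (_≡_; _≢_; refl; sym; trans; cong; cong₂)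
open import Relation.Nullary using (¬_; yes; no; contradiction)
open import Relation.Nullary.Decidable using (⌊_⌋)

------------------------------------------------------------------------
-- Edge sets and graphs

-- A set of two-element subsets of Fin n, given by its characteristic
-- function on ordered pairs.
record EdgeSet (n : ℕ) : Set where
  field
    mem        : Fin n → Fin n → Bool
    mem-sym    : ∀ u v → mem u v ≡ mem v u
    mem-irrefl : ∀ u → mem u u ≡ false

  Adj : Fin n → Fin n → Set
  Adj u v = T (mem u v)

open EdgeSet public using (Adj)

_⊆ᴱ_ : ∀ {n} → EdgeSet n → EdgeSet n → Set
E ⊆ᴱ F = ∀ {u v} → Adj E u v → Adj F u v

EdgeDisjoint : ∀ {n} → EdgeSet n → EdgeSet n → Set
EdgeDisjoint E F = ∀ {u v} → ¬ (Adj E u v × Adj F u v)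

-- Each edge is counted once, at its ordered representative u < v.
∣_∣ᴱ : ∀ {n} → EdgeSet n → ℕ
∣_∣ᴱ {n} E = length (filterᵇ
  (λ (u , v) → (toℕ u <ᵇ toℕ v) ∧ EdgeSet.mem E u v)
  (cartesianProduct (allFin n) (allFin n)))

record Graph (n : ℕ) : Set where
  constructor graph
  field
    edges : EdgeSet n

open Graph public

record _≅_ {n : ℕ} (G H : Graph n) : Set where
  field
    bijection : Permutation n n
    adj-cong  : ∀ u v →
      EdgeSet.mem (edges H) (bijection ⟨$⟩ʳ u) (bijection ⟨$⟩ʳ v)
        ≡ EdgeSet.mem (edges G) u v

K : ∀ n → Graph n
K n = graph record
  { mem        = λ u v → not ⌊ u ≟ v ⌋
  ; mem-sym    = λ u v → cong not (≟-sym u v)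
  ; mem-irrefl = λ u → ≟-irrefl u
  }
  where
  ≟-sym : (u v : Fin n) → ⌊ u ≟ v ⌋ ≡ ⌊ v ≟ u ⌋
  ≟-sym u v with u ≟ v | v ≟ u
  ... | yes _   | yes _   = refl
  ... | no _    | no _    = refl
  ... | yes u≡v | no v≢u  = contradiction (sym u≡v) v≢u
  ... | no u≢v  | yes v≡u = contradiction (sym v≡u) u≢v

  ≟-irrefl : (u : Fin n) → not ⌊ u ≟ u ⌋ ≡ false
  ≟-irrefl u with u ≟ u
  ... | yes _  = refl
  ... | no u≢u = contradiction refl u≢u

_∖_ : ∀ {n} → Graph n → EdgeSet n → Graph n
G ∖ M = graph record
  { mem        = λ u v → E.mem u v ∧ not (M.mem u v)
  ; mem-sym    = λ u v → cong₂ (λ a b → a ∧ not b) (E.mem-sym u v) (M.mem-sym u v)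
  ; mem-irrefl = λ u → trans (cong (_∧ not (M.mem u u)) (E.mem-irrefl u))
                             (∧-zeroˡ (not (M.mem u u)))
  }
  where
  module E = EdgeSet (edges G)
  module M = EdgeSet M

------------------------------------------------------------------------
-- Connectedness, acyclicity and trees

ConnectedOn : ∀ {n} → Subset n → EdgeSet n → Set
ConnectedOn V E = Nonempty V × (∀ {u v} → u ∈ V → v ∈ V → Star (Adj E) u v)

Connected : ∀ {n} → Graph n → Set
Connected G = ConnectedOn ⊤ (edges G)

-- A cycle v, v₁, …, vₘ, v with m ≥ 2 and v, v₁, …, vₘ distinct.
IsCycle : ∀ {n} → EdgeSet n → Fin n → List (Fin n) → Set
IsCycle E v vs = 2 ≤ length vs × Unique (v ∷ vs) × Linked (Adj E) (v ∷ vs ++ v ∷ [])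

Acyclic : ∀ {n} → EdgeSet n → Set
Acyclic E = ∀ v vs → ¬ IsCycle E v vs

record Subgraph {n : ℕ} (G : Graph n) : Set where
  field
    vertexSet : Subset n
    edgeSet   : EdgeSet n
    edge⊆     : edgeSet ⊆ᴱ edges G
    -- By symmetry of adjacency, v ∈ vertexSet follows as well.
    endpoint  : ∀ {u v} → Adj edgeSet u v → u ∈ vertexSet

open Subgraph public

IsTree : ∀ {n} {G : Graph n} → Subgraph G → Set
IsTree T = ConnectedOn (vertexSet T) (edgeSet T) × Acyclic (edgeSet T)

record TreeConnecting {n : ℕ} (G : Graph n) (S : Subset n) : Set where
  field
    subgraph : Subgraph G
    isTree   : IsTree subgraph
    connects : S ⊆ vertexSet subgraph

open TreeConnecting public

------------------------------------------------------------------------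
-- Generalized edge-connectivity

IsMaximum : (ℕ → Set) → ℕ → Set
IsMaximum P m = P m × (∀ j → P j → j ≤ m)

IsMinimum : (ℕ → Set) → ℕ → Set
IsMinimum P m = P m × (∀ j → P j → m ≤ j)

EdgeDisjointTrees : ∀ {n} → Graph n → Subset n → ℕ → Set
EdgeDisjointTrees G S m =
  Σ[ T ∈ (Fin m → TreeConnecting G S) ]
    (∀ i j → i ≢ j → EdgeDisjoint (edgeSet (subgraph (T i))) (edgeSet (subgraph (T j))))

-- λ(S) = m.  This is functional only for S with at least two vertices:
-- otherwise edgeless trees can be repeated and there is no maximum.
λ[_,_]≡_ : ∀ {n} → Graph n → Subset n → ℕ → Set
λ[ G , S ]≡ m = IsMaximum (EdgeDisjointTrees G S) m

-- λₖ(G) = m.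
λ⟨_⟩[_]≡_ : ∀ {n} → ℕ → Graph n → ℕ → Set
λ⟨_⟩[_]≡_ {n} k G m = IsMinimum (λ j → ∃[ S ] (∣ S ∣ ≡ k × λ[ G , S ]≡ j)) m

-- Edges are coloured so that every tree lies in a colour class.  Inside S, K_{2q+1} without q edges
-- has q edge-disjoint spanning connected subgraphs, by induction on q: remove an end a of a forbidden
-- edge and a vertex b on no forbidden edge, reserve an edge for each further forbidden edge at a, and
-- use the rest of the stars at a and b for one new tree.  Each vertex outside S contributes a star,
-- whose missing rays are replaced by reserved edges inside S; reserved edges count as forbidden in the
-- remaining construction, so the number of forbidden edges never grows.
--
-- Conversely, a tree connecting S uses k - 1 edges inside S or at least k edges that meet S.  Counting
-- these edges bounds the number of trees, and p + 1 missing edges at S make the bound strict, where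
-- p = 0 for even k and p = ⌊k/2⌋ for odd k.
module Submission where

open import Defs
open import Data.Bool.Base using (Bool; _∧_; not; true; false; if_then_else_; T)
open import Data.Bool.Properties using (T?; T-∧; not-involutive)
open import Data.Empty using (⊥; ⊥-elim)
import Data.Fin.Base as Fin
open import Data.Fin.Base using (Fin; zero; suc; toℕ)
open import Data.Fin.Permutation using (_⟨$⟩ʳ_; _⟨$⟩ˡ_; id; inverseˡ)
import Data.Fin.Properties as Fin
open import Data.Fin.Properties using (_≟_; any?; toℕ<n; toℕ-injective)
open import Data.Fin.Subset using (Subset; ∣_∣; ∁) renaming (_∈_ to _∈ˢ_; _⊆_ to _⊆ˢ_; ⊥ to ⊥ˢ)
open import Data.Fin.Subset.Properties
  using (∣p∣≤n; ∣⊥∣≡0; x∈∁p⇒x∉p; x∉p⇒x∈∁p; ∣∁p∣≡n∸∣p∣)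
  renaming (_∈?_ to _∈ˢ?_)
open import Data.List.Base
  using (List; []; _∷_; _++_; length; filter; map; take; drop; allFin; tabulate; concat;
    cartesianProduct; filterᵇ)
import Data.List.Membership.DecPropositional as DecMembership
open import Data.List.Membership.Propositional using (_∈_; _∉_; find)
open import Data.List.Membership.Propositional.Properties
  using (∈-∃++; ∈-++⁺ˡ; ∈-++⁺ʳ; ∈-++⁻; ∈-map⁺; ∈-map⁻; ∈-filter⁺; ∈-filter⁻; ∈-allFin; ∈-concat⁻′;
    ∈-tabulate⁻; ∈-cartesianProduct⁺)
open import Data.List.Properties
  using (length-++; length-map; length-filter; length-take; length-drop; take++drop≡id; length-tabulate;
    map-id-local; take-map)
open import Data.List.Relation.Binary.Disjoint.Propositional using (Disjoint)
open import Data.List.Relation.Binary.Permutation.Propositional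
  using (_↭_; ↭-refl; ↭-sym; ↭-trans; ↭-reflexive; prep; ↭⇒↭ₛ)
open import Data.List.Relation.Binary.Permutation.Propositional.Properties
  using (∈-resp-↭; ↭-length; shift; ++-comm)
import Data.List.Relation.Binary.Permutation.Setoid.Properties as PermutationSetoid
open import Data.List.Relation.Unary.All as All using (All; []; _∷_)
import Data.List.Relation.Unary.All.Properties as AllP
open import Data.List.Relation.Unary.All.Properties using (¬All⇒Any¬; ¬Any⇒All¬)
open import Data.List.Relation.Unary.AllPairs using ([]; _∷_)
import Data.List.Relation.Unary.AllPairs.Properties as AllPairs
open import Data.List.Relation.Unary.Any using (here; there)
open import Data.List.Relation.Unary.Linked as Linked using (Linked; []; _∷_)
open import Data.List.Relation.Unary.Unique.Propositional using (Unique)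
import Data.List.Relation.Unary.Unique.Propositional.Properties as Unique
open import Data.Nat.Base using (ℕ; ⌈_/2⌉; _<ᵇ_; zero; suc; _+_; _∸_; _*_; _≤_; _<_; z≤n; s≤s; s≤s⁻¹)
open import Data.Nat.DivMod using (_/_; m*n/n≡m)
open import Data.Nat.Divisibility using (_∣_; divides; ∣⇒≤; ∣m+n∣m⇒∣n)
open import Data.Nat.ListAction using (sum)
import Data.Nat.Properties as ℕ
open import Data.Nat.Properties
  using (≤-refl; ≤-trans; ≤-reflexive; +-suc; +-comm; +-assoc; +-mono-≤; +-monoˡ-≤; +-monoʳ-≤;
    suc-injective; m≤n⇒m<n∨m≡n; <⇒≱; ≰⇒>; <-irrefl; m≤n+m; m≤m+n; m+n∸m≡n; m≤n⇒m⊓n≡m; n≤1+n; ≤⇒≯;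
    +-identityʳ; <-cmp; <-trans; ≤-antisym; _≤?_)
open import Data.Nat.Tactic.RingSolver using (solve-∀)
open import Data.Product.Base as Product using (_×_; _,_; _,′_; ∃-syntax; Σ-syntax; proj₁; proj₂)
open import Data.Product.Properties using (≡-dec; ,-injective)
open import Data.Sum.Base as Sum using (_⊎_; inj₁; inj₂; swap; [_,_]′)
open import Data.Unit.Base using (⊤; tt)
open import Data.Vec.Base as Vec using (here; there)
open import Data.Vec.Properties using (lookup⇒[]=; []=⇒lookup; lookup∘tabulate)
open import Function.Base using (_∘_; const; case_of_)
open import Function.Bundles using (_⇔_; mk⇔; Equivalence)
open import Level using (0ℓ)
open import Relation.Binary.Construct.Closure.ReflexiveTransitive as Star using (Star; ε; _◅_; _◅◅_)
open import Relation.Binary.Definitions using (tri<; tri≈; tri>)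
open import Relation.Binary.PropositionalEquality
  using (_≡_; _≢_; refl; sym; trans; cong; cong₂; subst; subst₂; setoid; ≢-sym)
open import Relation.Nullary using (¬_; Dec; yes; no; does; contradiction)
open import Relation.Nullary.Decidable
  using (_⊎-dec_; _×-dec_; ¬?; dec-true; dec-false; does-⇔; decidable-stable)
open import Relation.Unary using (Pred; Decidable)

-- The parity of k enters through one count: q trees inside S take q(k - 1) of the k(k - 1)/2 pairs.
-- For k = 2q that is every pair; for k = 2q + 1 exactly q pairs are left over, and these are the
-- ones that may be missing.
--
-- The odd induction matches this balance: two more vertices allow one more tree and one more
-- forbidden edge. The forbidden edge chosen at the start disappears together with its end a, so the
-- others already fit the smaller bound, and each reserved edge is paid for by another forbidden
-- edge that disappears with a. Since reserved edges depend on where the forbidden ones lie, the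
-- induction hypothesis must cover all short lists of forbidden edges.
--
-- In the converse the obstacle is logical. The hypothesis speaks only of sets S whose maximum
-- exists, and no maximum is computed here. A maximum exists up to double negation, which is enough
-- because the desired bound on the number of missing edges is decidable.

private variable
  X : Set

-- Lists without repetitions: splitting and counting

Unique-resp-↭ : {xs ys : List X} → xs ↭ ys → Unique xs → Unique ys
Unique-resp-↭ σ = PermutationSetoid.Unique-resp-↭ (setoid _) (↭⇒↭ₛ σ)

∈⇒↭ : {x : X} {xs : List X} → x ∈ xs → ∃[ ys ] xs ↭ x ∷ ys
∈⇒↭ {x = x} x∈xs with ∈-∃++ x∈xs
... | ys , zs , refl = ys ++ zs , shift x ys zs

unique-head : {x : X} {xs : List X} → Unique (x ∷ xs) → x ∉ xs
unique-head (x≢xs ∷ _) x∈xs = All.lookup x≢xs x∈xs refl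

unique-⊆-length : {xs ys : List X} → Unique xs → (∀ {x} → x ∈ xs → x ∈ ys) → length xs ≤ length ys
unique-⊆-length {xs = []}     _ _ = z≤n
unique-⊆-length {xs = x ∷ xs} u@(_ ∷ uniq) sub with ∈⇒↭ (sub (here refl))
... | zs , σ = ≤-trans (s≤s (unique-⊆-length uniq rest)) (≤-reflexive (sym (↭-length σ)))
  where
  rest : ∀ {y} → y ∈ xs → y ∈ zs
  rest y∈xs with ∈-resp-↭ σ (sub (there y∈xs))
  ... | here refl = contradiction y∈xs (unique-head u)
  ... | there y∈zs = y∈zs

Unique-++⁻ : (xs : List X) {ys : List X} → Unique (xs ++ ys) →
  Unique xs × Unique ys × (∀ {x} → x ∈ xs → x ∉ ys)
Unique-++⁻ []       u = [] , u , λ ()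
Unique-++⁻ (x ∷ xs) u@(x≢ ∷ uniq) with Unique-++⁻ xs uniq
... | uxs , uys , disj =
  All.tabulate (λ y∈ → All.lookup x≢ (∈-++⁺ˡ y∈)) ∷ uxs , uys ,
  λ { (here refl) x∈ys → unique-head u (∈-++⁺ʳ xs x∈ys) ; (there y∈) → disj y∈ }

inhabited : (xs : List X) → 0 < length xs → ∃[ x ] x ∈ xs
inhabited (x ∷ _) _ = x , here refl

filter-split : {P : Pred X 0ℓ} (P? : Decidable P) (xs : List X) → filter P? xs ++ filter (¬? ∘ P?) xs ↭ xs
filter-split P? [] = ↭-refl
filter-split P? (x ∷ xs) with does (P? x)
... | true  = prep x (filter-split P? xs)
... | false = ↭-trans (shift x (filter P? xs) _) (prep x (filter-split P? xs))

length-filter-split : {P : Pred X 0ℓ} (P? : Decidable P) (xs : List X) →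
  length (filter P? xs) + length (filter (¬? ∘ P?) xs) ≡ length xs
length-filter-split P? xs = trans (sym (length-++ (filter P? xs))) (↭-length (filter-split P? xs))

∈-take : ∀ m {xs : List X} {x} → x ∈ take m xs → x ∈ xs
∈-take m {xs} x∈ = subst (_ ∈_) (take++drop≡id m xs) (∈-++⁺ˡ x∈)

take-++-≤ : ∀ m (xs : List X) {ys} → m ≤ length xs → take m (xs ++ ys) ≡ take m xs
take-++-≤ zero    xs       _       = refl
take-++-≤ (suc m) (x ∷ xs) (s≤s p) = cong (x ∷_) (take-++-≤ m xs p)

length-take-≤ : ∀ m (xs : List X) → m ≤ length xs → length (take m xs) ≡ m
length-take-≤ m xs m≤ = trans (length-take m xs) (m≤n⇒m⊓n≡m m≤)

halve-avoiding : {P : Pred X 0ℓ} (P? : Decidable P) (q : ℕ) (zs : List X) → length zs ≡ q + q →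
  length (filter P? zs) ≤ q →
  ∃[ xs ] ∃[ ys ] (xs ++ ys ↭ zs × length xs ≡ q × length ys ≡ q × (∀ {x} → x ∈ xs → ¬ P x))
halve-avoiding {P = P} P? q zs ∣zs∣ few =
  take q ps , drop q ps ,
  ↭-trans (↭-reflexive (take++drop≡id q ps)) ps↭zs ,
  length-take-≤ q ps (subst (q ≤_) (sym ∣ps∣) (m≤m+n q q)) ,
  trans (length-drop q ps) (trans (cong (_∸ q) ∣ps∣) (m+n∸m≡n q q)) ,
  λ x∈ → proj₂ (∈-filter⁻ (¬? ∘ P?) {xs = zs}
           (∈-take q (subst (_ ∈_) (take-++-≤ q bad q≤) x∈)))
  where
  -- `good` holds the entries that satisfy `P`, the ones to be avoided. Those in `bad` are put
  -- first: there are at least q of them, so the first q entries of `ps` all avoid `P`.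
  good = filter P? zs
  bad = filter (¬? ∘ P?) zs
  ps = bad ++ good
  ps↭zs : ps ↭ zs
  ps↭zs = ↭-trans (++-comm bad good) (filter-split P? zs)
  ∣ps∣ : length ps ≡ q + q
  ∣ps∣ = trans (↭-length ps↭zs) ∣zs∣
  q≤ : q ≤ length bad
  q≤ = ℕ.+-cancelˡ-≤ q q (length bad)
         (≤-trans (≤-reflexive (sym (trans (length-filter-split P? zs) ∣zs∣))) (+-monoˡ-≤ (length bad) few))

-- The pairs in `R` become reserved edges, so its length matters: one reserved edge per entry of
-- `ys`, to be weighed against the forbidden edges that are dropped.
choose-partners : {Q : X → X → Set} (ys : List X) → (∀ {y} → y ∈ ys → ∃[ t ] Q y t) →
  ∃[ R ] (length R ≡ length ys
    × (∀ {y t} → (y , t) ∈ R → y ∈ ys × Q y t)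
    × (∀ {y} → y ∈ ys → ∃[ t ] ((y , t) ∈ R × Q y t)))
choose-partners [] _ = [] , refl , (λ ()) , (λ ())
choose-partners (y ∷ ys) f with f (here refl) | choose-partners ys (f ∘ there)
... | t , qt | R , len , sound , total =
  (y , t) ∷ R , cong suc len ,
  (λ { (here refl) → here refl , qt ; (there m) → let y∈ , q = sound m in there y∈ , q }) ,
  (λ { (here refl) → t , here refl , qt ; (there m) → let t′ , m′ , q = total m in t′ , there m′ , q })

-- Colourings that avoid forbidden pairs

module _ {n : ℕ} where

  private
    V = Fin n

  open DecMembership (_≟_ {n}) using (_∈?_)
  open DecMembership (≡-dec (_≟_ {n}) (_≟_ {n})) using () renaming (_∈?_ to _∈²?_)

  pigeonhole : {xs ys : List V} → Unique xs → length ys < length xs → ∃[ x ] (x ∈ xs × x ∉ ys)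
  pigeonhole {xs} {ys} uniq ys<xs with All.all? (_∈? ys) xs
  ... | yes xs⊆ys = contradiction (unique-⊆-length uniq (All.lookup xs⊆ys)) (<⇒≱ ys<xs)
  ... | no  xs⊈ys = find (¬All⇒Any¬ (_∈? ys) xs xs⊈ys)

  Hit : List (V × V) → V → V → Set
  Hit M u v = (u , v) ∈ M ⊎ (v , u) ∈ M

  hit? : ∀ M u v → Dec (Hit M u v)
  hit? M u v = ((u , v) ∈²? M) ⊎-dec ((v , u) ∈²? M)

  Touches : V → Pred (V × V) 0ℓ
  Touches a (u , v) = u ≡ a ⊎ v ≡ a

  touches? : ∀ a → Decidable (Touches a)
  touches? a (u , v) = (u ≟ a) ⊎-dec (v ≟ a)

  -- At a pair that does not touch `a` the value is an arbitrary end. This does no harm, since the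
  -- images over a list only have to include every partner of `a`.
  other : V → V × V → V
  other a (u , v) = if does (u ≟ a) then v else u

  other-left : ∀ a v → other a (a , v) ≡ v
  other-left a v rewrite dec-true (a ≟ a) refl = refl

  other-right : ∀ {a u} → u ≢ a → other a (u , a) ≡ u
  other-right {a} {u} u≢a rewrite dec-false (u ≟ a) u≢a = refl

  hit⇒other : ∀ {M a x} → x ≢ a → Hit M a x → x ∈ map (other a) M
  hit⇒other {a = a} {x} _ (inj₁ m)   = subst (_∈ _) (other-left a x) (∈-map⁺ (other a) m)
  hit⇒other {a = a}     x≢a (inj₂ m) = subst (_∈ _) (other-right x≢a) (∈-map⁺ (other a) m)

  hit-filter : ∀ {M u v} {P : Pred (V × V) 0ℓ} (P? : Decidable P) →
    P (u , v) → P (v , u) → Hit M u v → Hit (filter P? M) u v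
  hit-filter P? p _ (inj₁ m) = inj₁ (∈-filter⁺ P? m p)
  hit-filter P? _ p (inj₂ m) = inj₂ (∈-filter⁺ P? m p)

  hit-++ˡ : ∀ {M N u v} → Hit M u v → Hit (M ++ N) u v
  hit-++ˡ = Sum.map ∈-++⁺ˡ ∈-++⁺ˡ

  hit-++ʳ : ∀ M {N u v} → Hit N u v → Hit (M ++ N) u v
  hit-++ʳ M = Sum.map (∈-++⁺ʳ M) (∈-++⁺ʳ M)

  -- Different partners of `a` need different forbidden edges at `a`. When `a` is removed these
  -- edges go with it and make room for one reserved edge per lost partner.
  hits-≤-touching : ∀ {a M} {xs : List V} → Unique xs → (∀ {x} → x ∈ xs → x ≢ a × Hit M a x) →
    length xs ≤ length (filter (touches? a) M)
  hits-≤-touching {a} {M} uniq hits =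
    ≤-trans (unique-⊆-length {ys = map (other a) (filter (touches? a) M)} uniq λ x∈ → let x≢a , h = hits x∈ in
              hit⇒other x≢a (hit-filter (touches? a) (inj₁ refl) (inj₂ refl) h))
            (≤-reflexive (length-map (other a) (filter (touches? a) M)))

  extend : V → (V → ℕ) → (V → V → ℕ) → V → V → ℕ
  extend x f C u v = if does (u ≟ x) then f v else if does (v ≟ x) then f u else C u v

  extend-sym : ∀ x f {C : V → V → ℕ} → (∀ u v → C u v ≡ C v u) → ∀ u v → extend x f C u v ≡ extend x f C v u
  extend-sym x f C-sym u v with u ≟ x | v ≟ x
  ... | yes refl | yes refl = refl
  ... | yes _    | no _     = refl
  ... | no _     | yes _    = refl
  ... | no _     | no _     = C-sym u v

  extend-at : ∀ x f C v → extend x f C x v ≡ f v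
  extend-at x f C v rewrite dec-true (x ≟ x) refl = refl

  extend-away : ∀ {x f C u v} → u ≢ x → v ≢ x → extend x f C u v ≡ C u v
  extend-away {x} {u = u} {v} u≢x v≢x rewrite dec-false (u ≟ x) u≢x | dec-false (v ≟ x) v≢x = refl

  recolour : List (V × V) → ℕ → (V → V → ℕ) → V → V → ℕ
  recolour R t C u v = if does (hit? R u v) then t else C u v

  recolour-hit : ∀ {R t C u v} → Hit R u v → recolour R t C u v ≡ t
  recolour-hit {R} {u = u} {v} h rewrite dec-true (hit? R u v) h = refl

  recolour-miss : ∀ {R t C u v} → ¬ Hit R u v → recolour R t C u v ≡ C u v
  recolour-miss {R} {u = u} {v} h rewrite dec-false (hit? R u v) h = refl

  recolour-sym : ∀ R t {C : V → V → ℕ} → (∀ u v → C u v ≡ C v u) → ∀ u v → recolour R t C u v ≡ recolour R t C v u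
  recolour-sym R t {C} C-sym u v = case hit? R u v of λ where
    (yes h) → trans (recolour-hit {C = C} h) (sym (recolour-hit {C = C} (swap h)))
    (no ¬h) → trans (recolour-miss {C = C} ¬h) (trans (C-sym u v) (sym (recolour-miss {C = C} (¬h ∘ swap))))

  -- Equals length xs when v does not occur.
  index : List V → V → ℕ
  index []       v = 0
  index (x ∷ xs) v = if does (v ≟ x) then 0 else suc (index xs v)

  -- With `xs` of length q, the default value is the colour of the new tree, so `index xs` alone
  -- colours the whole star at a vertex: old colours towards `xs`, the new one elsewhere.
  index-absent : ∀ {xs v} → v ∉ xs → index xs v ≡ length xs
  index-absent {[]}     _ = refl
  index-absent {x ∷ xs} {v} v∉ rewrite dec-false (v ≟ x) (v∉ ∘ here) = cong suc (index-absent (v∉ ∘ there))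

  index-surjective : ∀ {xs} → Unique xs → ∀ {i} → i < length xs → ∃[ x ] (x ∈ xs × index xs x ≡ i)
  index-surjective {x ∷ xs} _ {zero} _ =
    x , here refl , cong (if_then 0 else suc (index xs x)) (dec-true (x ≟ x) refl)
  index-surjective {x ∷ xs} u@(_ ∷ uniq) {suc i} (s≤s i<) with index-surjective uniq i<
  ... | y , y∈ , eq = y , there y∈ ,
        trans (cong (if_then 0 else suc (index xs y)) (dec-false (y ≟ x) λ { refl → unique-head u y∈ })) (cong suc eq)

  record Link (A : List V) (M : List (V × V)) (C : V → V → ℕ) (i : ℕ) (u v : V) : Set where
    constructor link
    field
      left∈  : u ∈ A
      right∈ : v ∈ A
      distinct : u ≢ v
      allowed : ¬ Hit M u v
      coloured : C u v ≡ i

  -- A colouring makes the trees disjoint by construction and leaves only connectivity to be carried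
  -- along. Walks may use all of `A`, while only `L` has to be linked; the two differ once vertices
  -- outside S take part. Forbidden pairs have colours too, but no link uses them.
  record Packing (A L : List V) (M : List (V × V)) (t : ℕ) : Set where
    field
      colour     : V → V → ℕ
      colour-sym : ∀ u v → colour u v ≡ colour v u
      linked     : ∀ {i} → i < t → ∀ {u v} → u ∈ L → v ∈ L → Star (Link A M colour i) u v

  link-sym : ∀ {A M C i u v} → (∀ u v → C u v ≡ C v u) → Link A M C i u v → Link A M C i v u
  link-sym C-sym (link a b c d e) = link b a (c ∘ sym) (d ∘ swap) (trans (C-sym _ _) e)

  linked-via-root : ∀ {A M C i} {L : List V} → (∀ u v → C u v ≡ C v u) →
    ∀ r → (∀ {u} → u ∈ L → Star (Link A M C i) u r) → ∀ {u v} → u ∈ L → v ∈ L → Star (Link A M C i) u v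
  linked-via-root C-sym r to u∈ v∈ = to u∈ ◅◅ Star.reverse (link-sym C-sym) (to v∈)

  packing-map : ∀ {A L M A′ L′ M′ t} → (∀ {x} → x ∈ A → x ∈ A′) → (∀ {x} → x ∈ L′ → x ∈ L) →
    (∀ {u v} → u ∈ A → v ∈ A → u ≢ v → Hit M′ u v → Hit M u v) → Packing A L M t → Packing A′ L′ M′ t
  packing-map A⊆ L⊇ hit P = record
    { colour = colour
    ; colour-sym = colour-sym
    ; linked = λ i< u∈ v∈ → Star.map (λ { (link a b c d e) → link (A⊆ a) (A⊆ b) c (d ∘ hit a b c) e })
                              (linked i< (L⊇ u∈) (L⊇ v∈)) }
    where open Packing P

-- The recursion step for odd orders

module _ {n : ℕ} where

  private
    V = Fin n

  open DecMembership (_≟_ {n}) using (_∈?_)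

  Inside : List V → Pred (V × V) 0ℓ
  Inside L (u , v) = u ∈ L × v ∈ L × u ≢ v

  endpoints : List (V × V) → List V
  endpoints M = map proj₁ M ++ map proj₂ M

  length-endpoints : ∀ M → length (endpoints M) ≡ length M + length M
  length-endpoints M = trans (length-++ (map proj₁ M)) (cong₂ _+_ (length-map proj₁ M) (length-map proj₂ M))

  hit⇒endpoint : ∀ {M u v} → Hit M u v → u ∈ endpoints M
  hit⇒endpoint     (inj₁ m) = ∈-++⁺ˡ (∈-map⁺ proj₁ m)
  hit⇒endpoint {M} (inj₂ m) = ∈-++⁺ʳ (map proj₁ M) (∈-map⁺ proj₂ m)

  -- The pair `(a , v)` itself reaches no vertex of `Z`, so it does not count. This saves one edge,
  -- both in splitting `Z` and in bounding the reserved edges by `M` alone.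
  other-hits-≤-touching : ∀ {a v M} {Z zs : List V} → a ≢ v → All (a ≢_) Z → All (v ≢_) Z → Unique zs →
    (∀ {z} → z ∈ zs → z ∈ Z × Hit ((a , v) ∷ M) a z) → length zs ≤ length (filter (touches? a) M)
  other-hits-≤-touching {M = M} a≢v a≢Z v≢Z uzs hits = hits-≤-touching {M = M} uzs λ z∈ →
    let z∈Z , h = hits z∈ in
    ≢-sym (All.lookup a≢Z z∈Z) , (case h of λ where
      (inj₁ (here refl)) → contradiction refl (All.lookup v≢Z z∈Z)
      (inj₂ (here refl)) → contradiction refl a≢v
      (inj₁ (there m)) → inj₁ m
      (inj₂ (there m)) → inj₂ m)

  -- The recursion step from 2q+1 to 2q+3 vertices.  The vertex a loses its edge to v, the vertex b
  -- loses none.  Tree i < q is extended by the edges from a to the i-th element of xs and from b to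
  -- the i-th element of ys.  The new tree consists of all remaining edges at a and b, where each y
  -- in ys with a y forbidden is reattached to v or xs by an edge reserved in advance.
  odd-packing-step : ∀ q a v b (Z : List V) (M : List (V × V)) →
    Unique (a ∷ v ∷ b ∷ Z) → length Z ≡ q + q → length M ≤ q →
    All (Inside (a ∷ v ∷ b ∷ Z)) M → b ∉ endpoints ((a , v) ∷ M) →
    (∀ (L : List V) M → Unique L → length L ≡ suc (q + q) → length M ≤ q → All (Inside L) M → Packing L L M q) →
    Packing (a ∷ v ∷ b ∷ Z) (a ∷ v ∷ b ∷ Z) ((a , v) ∷ M) (suc q)
  odd-packing-step q a v b Z M uniq ∣Z∣ ∣M∣ inside b∉ rec
    with uniq
  ... | (a≢v ∷ a≢b ∷ a≢Z) ∷ (v≢b ∷ v≢Z) ∷ b≢Z ∷ uZ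
    -- The edges from `a` to `xs` carry the old colours and must all be allowed. At most q of the 2q
    -- vertices of `Z` are forbidden partners of `a`, so q allowed ones remain.
    with halve-avoiding (hit? ((a , v) ∷ M) a) q Z ∣Z∣
           (≤-trans (other-hits-≤-touching a≢v a≢Z v≢Z (Unique.filter⁺ (hit? ((a , v) ∷ M) a) uZ)
                       (∈-filter⁻ (hit? ((a , v) ∷ M) a)))
                    (≤-trans (length-filter (touches? a) M) ∣M∣))
  ... | xs , ys , σ , ∣xs∣ , ∣ys∣ , free
    = record
    { colour = C
    ; colour-sym = C-sym
    ; linked = λ i< → case m≤n⇒m<n∨m≡n (s≤s⁻¹ i<) of λ where
        (inj₁ i<q) → linked-via-root C-sym v (old i<q)
        (inj₂ refl) → linked-via-root C-sym b new }
    where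
    N = (a , v) ∷ M
    A = a ∷ v ∷ b ∷ Z
    L = v ∷ xs ++ ys

    xs⊆Z : ∀ {x} → x ∈ xs → x ∈ Z
    xs⊆Z x∈ = ∈-resp-↭ σ (∈-++⁺ˡ x∈)
    ys⊆Z : ∀ {y} → y ∈ ys → y ∈ Z
    ys⊆Z y∈ = ∈-resp-↭ σ (∈-++⁺ʳ xs y∈)
    L⊆A : ∀ {x} → x ∈ L → x ∈ A
    L⊆A (here refl) = there (here refl)
    L⊆A (there x∈) = there (there (there (∈-resp-↭ σ x∈)))
    a∉L : ∀ {x} → x ∈ L → x ≢ a
    a∉L (here refl) refl = a≢v refl
    a∉L (there x∈) refl = All.lookup a≢Z (∈-resp-↭ σ x∈) refl
    b∉L : ∀ {x} → x ∈ L → x ≢ b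
    b∉L (here refl) refl = v≢b refl
    b∉L (there x∈) refl = All.lookup b≢Z (∈-resp-↭ σ x∈) refl
    uL : Unique L
    uL = Unique-resp-↭ (prep v (↭-sym σ)) (v≢Z ∷ uZ)
    uxsys : Unique (xs ++ ys)
    uxsys = Unique-resp-↭ (↭-sym σ) uZ
    uxs : Unique xs
    uxs = proj₁ (Unique-++⁻ xs uxsys)
    uys : Unique ys
    uys = proj₁ (proj₂ (Unique-++⁻ xs uxsys))
    xs∩ys : ∀ {x} → x ∈ xs → x ∉ ys
    xs∩ys = proj₂ (proj₂ (Unique-++⁻ xs uxsys))
    uvxs : Unique (v ∷ xs)
    uvxs = All.tabulate (λ x∈ → All.lookup v≢Z (xs⊆Z x∈)) ∷ uxs

    vxs⊆L : ∀ {x} → x ∈ v ∷ xs → x ∈ L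
    vxs⊆L (here refl) = here refl
    vxs⊆L (there x∈) = there (∈-++⁺ˡ x∈)
    ys⊆L : ∀ {x} → x ∈ ys → x ∈ L
    ys⊆L x∈ = there (∈-++⁺ʳ xs x∈)

    vxs∩ys : ∀ {x} → x ∈ v ∷ xs → x ∉ ys
    vxs∩ys (here refl) x∈ = All.lookup v≢Z (ys⊆Z x∈) refl
    vxs∩ys (there x∈) = xs∩ys x∈

    lost = filter (hit? N a) ys

    Reattaches : V → V → Set
    Reattaches y t = t ∈ v ∷ xs × y ≢ t × ¬ Hit N y t

    reattach : ∀ {y} → y ∈ lost → ∃[ t ] Reattaches y t
    reattach {y} y∈lost with ∈-filter⁻ (hit? N a) {xs = ys} y∈lost
    -- The q + 1 candidates `v ∷ xs` outnumber the at most q edges of `M`. The pair `(a , v)` rules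
    -- out none of them, because neither `y` nor a candidate equals `a`.
    ... | y∈ys , _ with pigeonhole {ys = map (other y) M} uvxs
           (s≤s (≤-trans (≤-reflexive (length-map (other y) M)) (≤-trans ∣M∣ (≤-reflexive (sym ∣xs∣)))))
    ... | t , t∈ , t∉ = t , t∈ , y≢t , λ where
        (inj₁ (here refl)) → a∉L (there (∈-++⁺ʳ xs y∈ys)) refl
        (inj₂ (here refl)) → a∉L (vxs⊆L t∈) refl
        (inj₁ (there m)) → t∉ (hit⇒other (≢-sym y≢t) (inj₁ m))
        (inj₂ (there m)) → t∉ (hit⇒other (≢-sym y≢t) (inj₂ m))
      where
      y≢t : y ≢ t
      y≢t refl = vxs∩ys t∈ y∈ys

    reserve = choose-partners lost reattach
    R = proj₁ reserve
    R-sound = proj₁ (proj₂ (proj₂ reserve))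
    R-total = proj₂ (proj₂ (proj₂ reserve))

    untouched = filter (¬? ∘ touches? a) M

    A-cases : ∀ {x} → x ∈ A → x ≢ a → x ≢ b → x ∈ L
    A-cases (here refl) x≢a _ = contradiction refl x≢a
    A-cases (there (here refl)) _ _ = here refl
    A-cases (there (there (here refl))) _ x≢b = contradiction refl x≢b
    A-cases (there (there (there x∈))) _ _ = there (∈-resp-↭ (↭-sym σ) x∈)

    inside′ : All (Inside L) (untouched ++ R)
    inside′ = All.tabulate λ m → case ∈-++⁻ untouched m of λ where
      (inj₁ m) → let m∈M , ¬touch = ∈-filter⁻ (¬? ∘ touches? a) {xs = M} m
                     u∈ , w∈ , u≢w = All.lookup inside m∈M in
        A-cases u∈ (¬touch ∘ inj₁) (λ { refl → b∉ (hit⇒endpoint {N} (inj₁ (there m∈M))) }) ,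
        A-cases w∈ (¬touch ∘ inj₂) (λ { refl → b∉ (hit⇒endpoint {N} (inj₂ (there m∈M))) }) , u≢w
      (inj₂ m) → let y∈lost , t∈ , y≢t , _ = R-sound m in
        ys⊆L (proj₁ (∈-filter⁻ (hit? N a) {xs = ys} y∈lost)) , vxs⊆L t∈ , y≢t

    ∣lost∣ : length lost ≤ length (filter (touches? a) M)
    ∣lost∣ = other-hits-≤-touching a≢v a≢Z v≢Z (Unique.filter⁺ (hit? N a) uys) λ z∈ →
      let z∈ys , h = ∈-filter⁻ (hit? N a) {xs = ys} z∈ in ys⊆Z z∈ys , h

    ∣M′∣ : length (untouched ++ R) ≤ q
    ∣M′∣ = ≤-trans (≤-reflexive (trans (length-++ untouched) (cong (length untouched +_) (proj₁ (proj₂ reserve)))))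
            (≤-trans (+-monoʳ-≤ (length untouched) ∣lost∣)
            (≤-trans (≤-reflexive (trans (+-comm (length untouched) _) (length-filter-split (touches? a) M))) ∣M∣))

    P : Packing L L (untouched ++ R) q
    P = rec L (untouched ++ R) uL
          (cong suc (trans (length-++ xs) (cong₂ _+_ ∣xs∣ ∣ys∣))) ∣M′∣ inside′
    open Packing P renaming (colour to C₀; colour-sym to C₀-sym)

    -- Only pairs of `R` change colour inside `L`, and the recursive packing does not use them. The
    -- pair of `a` and `b` is coloured by the outer extension with `index ys a`, which is q because
    -- `a` is not in `ys`.
    C₁ = recolour R q C₀
    C₂ = extend a (index xs) C₁
    C = extend b (index ys) C₂
    C-sym : ∀ u v → C u v ≡ C v u
    C-sym = extend-sym b _ (extend-sym a _ (recolour-sym R q C₀-sym))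

    C-on-L : ∀ {u w} → u ∈ L → w ∈ L → C u w ≡ C₁ u w
    C-on-L u∈ w∈ = trans (extend-away {C = C₂} (b∉L u∈) (b∉L w∈)) (extend-away {C = C₁} (a∉L u∈) (a∉L w∈))

    C-at-a : ∀ {w} → w ≢ b → C a w ≡ index xs w
    C-at-a {w} w≢b = trans (extend-away {C = C₂} a≢b w≢b) (extend-at a (index xs) C₁ w)

    b-allowed : ∀ {w} → ¬ Hit N b w
    b-allowed h = b∉ (hit⇒endpoint {N} h)

    a∈ : a ∈ A
    a∈ = here refl
    b∈ : b ∈ A
    b∈ = there (there (here refl))

    hit-L : ∀ {u w} → u ∈ L → w ∈ L → Hit N u w → Hit untouched u w
    hit-L u∈ w∈ (inj₁ (here refl)) = contradiction refl (a∉L u∈)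
    hit-L u∈ w∈ (inj₂ (here refl)) = contradiction refl (a∉L w∈)
    hit-L u∈ w∈ (inj₁ (there m)) = hit-filter (¬? ∘ touches? a) [ a∉L u∈ , a∉L w∈ ]′ [ a∉L w∈ , a∉L u∈ ]′ (inj₁ m)
    hit-L u∈ w∈ (inj₂ (there m)) = hit-filter (¬? ∘ touches? a) [ a∉L u∈ , a∉L w∈ ]′ [ a∉L w∈ , a∉L u∈ ]′ (inj₂ m)

    lift : ∀ {i u w} → Link L (untouched ++ R) C₀ i u w → Link A N C i u w
    lift (link u∈ w∈ u≢w ok col) = link (L⊆A u∈) (L⊆A w∈) u≢w (ok ∘ hit-++ˡ ∘ hit-L u∈ w∈)
      (trans (C-on-L u∈ w∈) (trans (recolour-miss {C = C₀} (ok ∘ hit-++ʳ untouched)) col))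

    old : ∀ {i} → i < q → ∀ {u} → u ∈ A → Star (Link A N C i) u v
    old i<q (here refl) = case index-surjective uxs (≤-trans i<q (≤-reflexive (sym ∣xs∣))) of λ where
      (x , x∈ , eq) → let x∈L = vxs⊆L (there x∈) in
        link a∈ (L⊆A x∈L) (≢-sym (a∉L x∈L)) (free x∈) (trans (C-at-a (b∉L x∈L)) eq)
        ◅ Star.map lift (linked i<q x∈L (here refl))
    old i<q (there (here refl)) = ε
    old i<q (there (there (here refl))) = case index-surjective uys (≤-trans i<q (≤-reflexive (sym ∣ys∣))) of λ where
      (y , y∈ , eq) → let y∈L = ys⊆L y∈ in
        link b∈ (L⊆A y∈L) (≢-sym (b∉L y∈L)) b-allowed (trans (extend-at b (index ys) C₂ y) eq)
        ◅ Star.map lift (linked i<q y∈L (here refl))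
    old i<q (there (there (there u∈))) =
      Star.map lift (linked i<q (there (∈-resp-↭ (↭-sym σ) u∈)) (here refl))

    to-b : ∀ {u} → u ∈ A → u ≢ b → u ∉ ys → Star (Link A N C q) u b
    to-b u∈ u≢b u∉ys = link-sym {A = A} {M = N} C-sym (link b∈ u∈ (≢-sym u≢b) b-allowed
      (trans (extend-at b (index ys) C₂ _) (trans (index-absent u∉ys) ∣ys∣))) ◅ ε

    vxs-to-b : ∀ {u} → u ∈ v ∷ xs → Star (Link A N C q) u b
    vxs-to-b u∈ = to-b (L⊆A (vxs⊆L u∈)) (b∉L (vxs⊆L u∈)) (vxs∩ys u∈)

    a-to-b : Star (Link A N C q) a b
    a-to-b = to-b a∈ a≢b λ a∈ys → a∉L (ys⊆L a∈ys) refl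

    ys-to-b : ∀ {y} → y ∈ ys → Star (Link A N C q) y b
    ys-to-b {y} y∈ = case hit? N a y of λ where
        (yes h) → case R-total (∈-filter⁺ (hit? N a) y∈ h) of λ where
          (t , m , t∈ , y≢t , ok) →
            link (L⊆A y∈L) (L⊆A (vxs⊆L t∈)) y≢t ok
              (trans (C-on-L y∈L (vxs⊆L t∈)) (recolour-hit {C = C₀} (inj₁ m)))
            ◅ vxs-to-b t∈
        (no ¬h) → link-sym {A = A} {M = N} C-sym (link a∈ (L⊆A y∈L) (≢-sym (a∉L y∈L)) ¬h
              (trans (C-at-a (b∉L y∈L)) (trans (index-absent (λ x∈ → xs∩ys x∈ y∈)) ∣xs∣)))
            ◅ a-to-b
      where
      y∈L = ys⊆L y∈

    new : ∀ {u} → u ∈ A → Star (Link A N C q) u b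
    new (here refl) = a-to-b
    new (there (here refl)) = vxs-to-b (here refl)
    new (there (there (here refl))) = ε
    new (there (there (there u∈))) = [ vxs-to-b ∘ there , ys-to-b ]′ (∈-++⁻ xs (∈-resp-↭ (↭-sym σ) u∈))

-- Packings inside S for both parities, and vertices outside S

module _ {n : ℕ} where

  private
    V = Fin n

  open DecMembership (_≟_ {n}) using (_∈?_)

  inside? : (L : List V) → Decidable (Inside L)
  inside? L (u , v) = (u ∈? L) ×-dec (v ∈? L) ×-dec ¬? (u ≟ v)

  odd-packing-nonempty : ∀ q (L : List V) N → 0 < length N → Unique L → length L ≡ suc (suc q + suc q) →
    length N ≤ suc q → All (Inside L) N →
    (∀ (L : List V) M → Unique L → length L ≡ suc (q + q) → length M ≤ q → All (Inside L) M → Packing L L M q) →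
    Packing L L N (suc q)
  odd-packing-nonempty q L N@((a , v) ∷ M) _ uL ∣L∣ (s≤s ∣M∣) ((a∈L , v∈L , a≢v) ∷ insideM) rec =
    case pigeonhole uL few of λ where
      (b , b∈L , b∉) →
        let L₁ , σ₁ = ∈⇒↭ a∈L
            v∈L₁ = ∈-tail σ₁ v∈L (≢-sym a≢v)
            b∈L₁ = ∈-tail σ₁ b∈L λ { refl → b∉ (here refl) }
            L₂ , σ₂ = ∈⇒↭ v∈L₁
            b∈L₂ = ∈-tail σ₂ b∈L₁ λ { refl → b∉ (hit⇒endpoint {M = N} (inj₂ (here refl))) }
            Z , σ₃ = ∈⇒↭ b∈L₂
            σ = ↭-trans σ₁ (prep a (↭-trans σ₂ (prep v σ₃)))
            ∣Z∣ = trans (sym (↭-length σ)) (trans ∣L∣ (cong (λ l → suc (suc l)) (+-suc q q)))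
        in packing-map (∈-resp-↭ (↭-sym σ)) (∈-resp-↭ σ) (λ _ _ _ h → h)
             (odd-packing-step q a v b Z M (Unique-resp-↭ σ uL)
               (suc-injective (suc-injective (suc-injective ∣Z∣))) ∣M∣
               (All.map (λ (u∈ , w∈ , u≢w) → ∈-resp-↭ σ u∈ , ∈-resp-↭ σ w∈ , u≢w) insideM) b∉ rec)
    where
    ∈-tail : ∀ {x y : V} {xs ys} → xs ↭ y ∷ ys → x ∈ xs → x ≢ y → x ∈ ys
    ∈-tail σ x∈ x≢y with ∈-resp-↭ σ x∈
    ... | here refl = contradiction refl x≢y
    ... | there x∈ys = x∈ys
    -- At most q + 1 forbidden edges have at most 2q + 2 ends, one fewer than the 2q + 3 vertices; a
    -- vertex that is left over serves as `b`.
    few : length (endpoints N) < length L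
    few = ≤-trans (s≤s (≤-trans (≤-reflexive (length-endpoints N)) (+-mono-≤ (s≤s ∣M∣) (s≤s ∣M∣))))
                  (≤-reflexive (sym ∣L∣))

  odd-packing-inside : ∀ q (L : List V) M → Unique L → length L ≡ suc (q + q) → length M ≤ q →
    All (Inside L) M → Packing L L M q
  odd-packing-inside zero L M _ _ _ _ = record
    { colour = λ _ _ → 0 ; colour-sym = λ _ _ → refl ; linked = λ () }
  odd-packing-inside (suc q) L N@(_ ∷ _) uL ∣L∣ ∣N∣ inside =
    odd-packing-nonempty q L N (s≤s z≤n) uL ∣L∣ ∣N∣ inside (odd-packing-inside q)
  -- With nothing forbidden, an arbitrary pair is forbidden artificially to supply the step with its
  -- `a` and `v`.
  odd-packing-inside (suc q) L@(a ∷ v ∷ _) [] uL@((a≢v ∷ _) ∷ _) ∣L∣ _ _ =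
    packing-map (λ x∈ → x∈) (λ x∈ → x∈) (λ { _ _ _ (inj₁ ()) ; _ _ _ (inj₂ ()) })
      (odd-packing-nonempty q L ((a , v) ∷ []) (s≤s z≤n) uL ∣L∣ (s≤s z≤n)
        ((here refl , there (here refl) , a≢v) ∷ []) (odd-packing-inside q))
  odd-packing-inside (suc q) (_ ∷ []) [] _ () _ _

  -- A link joins distinct vertices of `L`, so forbidden pairs that are not of this kind can be
  -- filtered out beforehand.
  odd-packing : ∀ q (L : List V) M → Unique L → length L ≡ suc (q + q) → length M ≤ q → Packing L L M q
  odd-packing q L M uL ∣L∣ ∣M∣ =
    packing-map (λ x∈ → x∈) (λ x∈ → x∈)
      (λ u∈ w∈ u≢w → hit-filter (inside? L) (u∈ , w∈ , u≢w) (w∈ , u∈ , ≢-sym u≢w))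
      (odd-packing-inside q L (filter (inside? L) M) uL ∣L∣ (≤-trans (length-filter (inside? L) M) ∣M∣)
        (All.tabulate (λ m → proj₂ (∈-filter⁻ (inside? L) {xs = M} m))))

  -- The new tree is a double star: b is joined to xs, and x is joined to ys by edges reserved in
  -- advance, while the i-th element of ys attaches b to tree i.
  even-packing : ∀ q (L : List V) → Unique L → length L ≡ q + q → Packing L L [] q
  even-packing zero L _ _ = record
    { colour = λ _ _ → 0 ; colour-sym = λ _ _ → refl ; linked = λ () }
  even-packing (suc q) (_ ∷ []) _ ∣L∣ = contradiction (trans (suc-injective ∣L∣) (+-suc q q)) λ ()
  even-packing (suc q) (b ∷ x ∷ Z′) (b≢Z ∷ uZ@(_ ∷ uZ′)) ∣L∣ = record
    { colour = C
    ; colour-sym = C-sym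
    ; linked = λ i< → case m≤n⇒m<n∨m≡n (s≤s⁻¹ i<) of λ where
        (inj₁ i<q) → linked-via-root C-sym x (old i<q)
        (inj₂ refl) → linked-via-root C-sym b new }
    where
    A = b ∷ x ∷ Z′
    xs = take q Z′
    ys = drop q Z′
    ∣Z′∣ : length Z′ ≡ q + q
    ∣Z′∣ = suc-injective (trans (suc-injective ∣L∣) (+-suc q q))
    ∣ys∣ : length ys ≡ q
    ∣ys∣ = trans (length-drop q Z′) (trans (cong (_∸ q) ∣Z′∣) (m+n∸m≡n q q))
    uys : Unique ys
    uys = Unique.drop⁺ q uZ′
    ys⊆ : ∀ {y} → y ∈ ys → y ∈ Z′
    ys⊆ y∈ = subst (_ ∈_) (take++drop≡id q Z′) (∈-++⁺ʳ xs y∈)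
    split : ∀ {y} → y ∈ Z′ → y ∈ xs ⊎ y ∈ ys
    split y∈ = ∈-++⁻ xs (subst (_ ∈_) (sym (take++drop≡id q Z′)) y∈)
    xs∩ys : ∀ {y} → y ∈ xs → y ∉ ys
    xs∩ys = proj₂ (proj₂ (Unique-++⁻ xs (subst Unique (sym (take++drop≡id q Z′)) uZ′)))
    x∉ys : x ∉ ys
    x∉ys x∈ = unique-head uZ (ys⊆ x∈)
    b∉ : ∀ {y} → y ∈ x ∷ Z′ → y ≢ b
    b∉ y∈ refl = All.lookup b≢Z y∈ refl

    -- These q reserved pairs exhaust the allowance of `odd-packing` on 2q + 1 vertices, so the even
    -- construction has no room for forbidden edges.
    R = map (_, x) ys
    P : Packing (x ∷ Z′) (x ∷ Z′) R q
    P = odd-packing q (x ∷ Z′) R uZ (cong suc ∣Z′∣) (≤-reflexive (trans (length-map (_, x) ys) ∣ys∣))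
    open Packing P renaming (colour to C₀; colour-sym to C₀-sym)

    C = extend b (index ys) (recolour R q C₀)
    C-sym : ∀ u v → C u v ≡ C v u
    C-sym = extend-sym b _ (recolour-sym R q C₀-sym)
    C-at-b : ∀ v → C b v ≡ index ys v
    C-at-b v = extend-at b (index ys) (recolour R q C₀) v
    C-away : ∀ {u v} → u ∈ x ∷ Z′ → v ∈ x ∷ Z′ → C u v ≡ recolour R q C₀ u v
    C-away u∈ v∈ = extend-away {C = recolour R q C₀} (b∉ u∈) (b∉ v∈)
    ok : ∀ {u v : V} → ¬ Hit [] u v
    ok (inj₁ ())
    ok (inj₂ ())

    lift : ∀ {i u v} → Link (x ∷ Z′) R C₀ i u v → Link A [] C i u v
    lift (link u∈ v∈ u≢v free col) = link (there u∈) (there v∈) u≢v ok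
      (trans (C-away u∈ v∈) (trans (recolour-miss {C = C₀} free) col))

    old : ∀ {i} → i < q → ∀ {u} → u ∈ A → Star (Link A [] C i) u x
    old i<q (here refl) = case index-surjective uys (≤-trans i<q (≤-reflexive (sym ∣ys∣))) of λ where
      (y , y∈ , e) → let y∈Z = there (ys⊆ y∈) in
        link (here refl) (there y∈Z) (≢-sym (b∉ y∈Z)) ok (trans (C-at-b y) e)
        ◅ Star.map lift (linked i<q y∈Z (here refl))
    old i<q (there u∈) = Star.map lift (linked i<q u∈ (here refl))

    to-b : ∀ {u} → u ∈ x ∷ Z′ → u ∉ ys → Star (Link A [] C q) u b
    to-b {u} u∈ u∉ys = link-sym {A = A} {M = []} C-sym (link (here refl) (there u∈) (≢-sym (b∉ u∈)) ok
      (trans (C-at-b u) (trans (index-absent u∉ys) ∣ys∣))) ◅ ε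

    new : ∀ {u} → u ∈ A → Star (Link A [] C q) u b
    new (here refl) = ε
    new (there (here refl)) = to-b (here refl) x∉ys
    new (there (there u∈)) = case split u∈ of λ where
      (inj₁ u∈xs) → to-b (there u∈) (xs∩ys u∈xs)
      (inj₂ u∈ys) → link (there (there u∈)) (there (here refl)) (λ { refl → x∉ys u∈ys }) ok
          (trans (C-away (there u∈) (here refl)) (recolour-hit {C = C₀} (inj₁ (∈-map⁺ (_, x) u∈ys))))
        ◅ to-b (here refl) x∉ys

  -- The new tree is the star at w, where each s in L with w s forbidden is attached to another
  -- vertex of L by an edge reserved in advance.
  packing-add-vertex : ∀ {p t} w (A L : List V) M → w ∉ A → (∀ {x} → x ∈ L → x ∈ A) → Unique L →
    length M ≤ p → suc p < length L → (∀ M → length M ≤ p → Packing A L M t) → Packing (w ∷ A) L M (suc t)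
  packing-add-vertex {p} {t} w A L M w∉A L⊆A uL ∣M∣ p<L rec = record
    { colour = C
    ; colour-sym = C-sym
    ; linked = λ i< → case m≤n⇒m<n∨m≡n (s≤s⁻¹ i<) of λ where
        (inj₁ i<t) u∈ v∈ → Star.map lift (linked i<t u∈ v∈)
        (inj₂ refl) → linked-via-root C-sym w new }
    where
    ∈A≢w : ∀ {x} → x ∈ A → x ≢ w
    ∈A≢w x∈ refl = w∉A x∈

    lost = filter (hit? M w) L

    Reattaches : V → V → Set
    Reattaches s x = x ∈ L × s ≢ x × ¬ Hit M s x × ¬ Hit M w x

    -- Each forbidden edge rules out at most one partner of s.
    ruled-out : V → V × V → V
    ruled-out s (u , v) = if does ((u ≟ s) ⊎-dec (u ≟ w)) then v else u

    hit⇒ruled-out : ∀ {s u x} → u ≡ s ⊎ u ≡ w → x ≢ s → x ≢ w → Hit M u x → x ∈ map (ruled-out s) M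
    hit⇒ruled-out {s} {u} {x} u≡ _ _ (inj₁ m) =
      subst (_∈ _) (cong (if_then x else u) (dec-true ((u ≟ s) ⊎-dec (u ≟ w)) u≡)) (∈-map⁺ (ruled-out s) m)
    hit⇒ruled-out {s} {u} {x} _ x≢s x≢w (inj₂ m) =
      subst (_∈ _) (cong (if_then u else x) (dec-false ((x ≟ s) ⊎-dec (x ≟ w)) [ x≢s , x≢w ]′)) (∈-map⁺ (ruled-out s) m)

    reattach : ∀ {s} → s ∈ lost → ∃[ x ] Reattaches s x
    -- The partner differs from `s` and is joined by allowed edges to both `s` and `w`. At most p +
    -- 1 vertices are excluded, namely `s` and one per forbidden edge, and `L` has more than that.
    reattach {s} _ = case pigeonhole {ys = s ∷ map (ruled-out s) M} uL
                            (≤-trans (s≤s (s≤s (≤-trans (≤-reflexive (length-map (ruled-out s) M)) ∣M∣))) p<L) of λ where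
      (x , x∈ , x∉) →
        x , x∈ , x∉ ∘ here ∘ sym ,
        x∉ ∘ there ∘ hit⇒ruled-out (inj₁ refl) (x∉ ∘ here) (∈A≢w (L⊆A x∈)) ,
        x∉ ∘ there ∘ hit⇒ruled-out (inj₂ refl) (x∉ ∘ here) (∈A≢w (L⊆A x∈))

    reserve = choose-partners lost reattach
    R = proj₁ reserve
    R-total = proj₂ (proj₂ (proj₂ reserve))
    untouched = filter (¬? ∘ touches? w) M

    ∣lost∣ : length lost ≤ length (filter (touches? w) M)
    ∣lost∣ = hits-≤-touching {M = M} (Unique.filter⁺ (hit? M w) uL) λ s∈ →
      let s∈L , h = ∈-filter⁻ (hit? M w) {xs = L} s∈ in ∈A≢w (L⊆A s∈L) , h

    ∣M′∣ : length (untouched ++ R) ≤ p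
    ∣M′∣ = ≤-trans (≤-reflexive (trans (length-++ untouched) (cong (length untouched +_) (proj₁ (proj₂ reserve)))))
            (≤-trans (+-monoʳ-≤ (length untouched) ∣lost∣)
            (≤-trans (≤-reflexive (trans (+-comm (length untouched) _) (length-filter-split (touches? w) M))) ∣M∣))

    P : Packing A L (untouched ++ R) t
    P = rec (untouched ++ R) ∣M′∣
    open Packing P renaming (colour to C₀; colour-sym to C₀-sym)

    C = extend w (const t) (recolour R t C₀)
    C-sym : ∀ u v → C u v ≡ C v u
    C-sym = extend-sym w _ (recolour-sym R t C₀-sym)
    C-away : ∀ {u v} → u ∈ A → v ∈ A → C u v ≡ recolour R t C₀ u v
    C-away u∈ v∈ = extend-away {C = recolour R t C₀} (∈A≢w u∈) (∈A≢w v∈)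

    lift : ∀ {i u v} → Link A (untouched ++ R) C₀ i u v → Link (w ∷ A) M C i u v
    lift (link u∈ v∈ u≢v free col) = link (there u∈) (there v∈) u≢v
      (free ∘ hit-++ˡ ∘ hit-filter (¬? ∘ touches? w) [ ∈A≢w u∈ , ∈A≢w v∈ ]′ [ ∈A≢w v∈ , ∈A≢w u∈ ]′)
      (trans (C-away u∈ v∈) (trans (recolour-miss {C = C₀} (free ∘ hit-++ʳ untouched)) col))

    to-w : ∀ {u} → u ∈ L → ¬ Hit M w u → Star (Link (w ∷ A) M C t) u w
    to-w {u} u∈ free = link-sym {A = w ∷ A} {M = M} C-sym
      (link (here refl) (there (L⊆A u∈)) (≢-sym (∈A≢w (L⊆A u∈))) free (extend-at w (const t) (recolour R t C₀) u)) ◅ ε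

    new : ∀ {u} → u ∈ L → Star (Link (w ∷ A) M C t) u w
    new {u} u∈ = case hit? M w u of λ where
      (no free) → to-w u∈ free
      (yes h) → case R-total (∈-filter⁺ (hit? M w) u∈ h) of λ where
        (x , m , x∈ , u≢x , free , free′) →
          link (there (L⊆A u∈)) (there (L⊆A x∈)) u≢x free
            (trans (C-away (L⊆A u∈) (L⊆A x∈)) (recolour-hit {C = C₀} (inj₁ m)))
          ◅ to-w x∈ free′

  -- The base must be available for every short list, since each added vertex replaces the forbidden
  -- list by another one of no greater length.
  packing-add-vertices : ∀ {p t} (L : List V) → Unique L → suc p < length L →
    (∀ M → length M ≤ p → Packing L L M t) →
    ∀ W → Unique W → (∀ {w} → w ∈ W → w ∉ L) → ∀ M → length M ≤ p → Packing (W ++ L) L M (length W + t)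
  packing-add-vertices L uL p<L base [] _ _ M ∣M∣ = base M ∣M∣
  packing-add-vertices L uL p<L base (w ∷ W) u@(_ ∷ uW) W∩L M ∣M∣ =
    packing-add-vertex w (W ++ L) L M
      (λ w∈ → [ unique-head u , W∩L (here refl) ]′ (∈-++⁻ W w∈)) (∈-++⁺ʳ W) uL ∣M∣ p<L
      (packing-add-vertices L uL p<L base W uW (W∩L ∘ there))

-- Growing a tree in a connected component

module _ {n : ℕ} where

  private
    V = Fin n

  open DecMembership (_≟_ {n}) using (_∈?_)

  index-injective : ∀ {xs : List V} {x y} → x ∈ xs → index xs x ≡ index xs y → x ≡ y
  index-injective {z ∷ xs} {x} {y} x∈ eq with x ≟ z | y ≟ z
  ... | yes refl | yes refl = refl
  ... | yes _    | no _     = contradiction eq λ ()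
  ... | no _     | yes _    = contradiction eq λ ()
  ... | no x≢z   | no _ with x∈
  ...   | here x≡z = contradiction x≡z x≢z
  ...   | there x∈xs = index-injective x∈xs (suc-injective eq)

  index-later : ∀ {xs : List V} {x v} → v ≢ x → index (x ∷ xs) v ≡ suc (index xs v)
  index-later {xs} {x} {v} v≢x = cong (if_then 0 else suc (index xs v)) (dec-false (v ≟ x) v≢x)

  -- Vertices are listed newest first, edges as (parent , child).
  data Growth (E : V → V → Set) (r : V) : List V → List (V × V) → Set where
    root : Growth E r (r ∷ []) []
    grow : ∀ {U F u v} → Growth E r U F → u ∈ U → v ∉ U → E u v → Growth E r (v ∷ U) ((u , v) ∷ F)

  module _ {E : V → V → Set} {r : V} where

    growth-unique : ∀ {U F} → Growth E r U F → Unique U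
    growth-unique root = [] ∷ []
    growth-unique (grow g _ v∉ _) = ¬Any⇒All¬ _ v∉ ∷ growth-unique g

    growth-root : ∀ {U F} → Growth E r U F → r ∈ U
    growth-root root = here refl
    growth-root (grow g _ _ _) = there (growth-root g)

    growth-ends : ∀ {U F u v} → Growth E r U F → (u , v) ∈ F → u ∈ U × v ∈ U
    growth-ends (grow g u∈ _ _) (here refl) = there u∈ , here refl
    growth-ends (grow g _ _ _) (there m) = Product.map there there (growth-ends g m)

    growth-edge : ∀ {U F u v} → Growth E r U F → (u , v) ∈ F → E u v
    growth-edge (grow _ _ _ e) (here refl) = e
    growth-edge (grow g _ _ _) (there m) = growth-edge g m

    growth-loopless : ∀ {U F u v} → Growth E r U F → (u , v) ∈ F → u ≢ v
    growth-loopless (grow g u∈ v∉ e) (here refl) refl = v∉ u∈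
    growth-loopless (grow g _ _ _) (there m) = growth-loopless g m

    growth-parent : ∀ {U F v} → Growth E r U F → v ∈ U → v ≡ r ⊎ v ∈ map proj₂ F
    growth-parent root (here refl) = inj₁ refl
    growth-parent (grow g _ _ _) (here refl) = inj₂ (here refl)
    growth-parent (grow g _ _ _) (there v∈) = Sum.map₂ there (growth-parent g v∈)

    growth-hit-ends : ∀ {U F u v} → Growth E r U F → Hit F u v → u ∈ U × v ∈ U
    growth-hit-ends g (inj₁ m) = growth-ends g m
    growth-hit-ends g (inj₂ m) = Product.swap (growth-ends g m)

    growth-linked : ∀ {U F v} → Growth E r U F → v ∈ U → Star (Hit F) v r
    growth-linked root (here refl) = ε
    growth-linked (grow g u∈ _ _) (here refl) = inj₂ (here refl) ◅ Star.map (Sum.map there there) (growth-linked g u∈)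
    growth-linked (grow g _ _ _) (there v∈) = Star.map (Sum.map there there) (growth-linked g v∈)

    -- Newer vertices have smaller index.
    growth-older-unique : ∀ {U F a b c} → Growth E r U F → Hit F a c → Hit F b c →
      index U c < index U a → index U c < index U b → a ≡ b
    growth-older-unique root (inj₁ ())
    growth-older-unique root (inj₂ ())
    growth-older-unique {v ∷ U} {(u , v) ∷ F} {a} {b} {c} (grow g u∈ v∉ e) ac bc c<a c<b with c ≟ v
    ... | yes refl = trans (parent ac) (sym (parent bc))
      where
      parent : ∀ {x} → Hit ((u , v) ∷ F) x v → x ≡ u
      parent (inj₁ (here refl)) = refl
      parent (inj₂ (here refl)) = contradiction u∈ v∉
      parent (inj₁ (there m)) = contradiction (proj₂ (growth-hit-ends g (inj₁ m))) v∉
      parent (inj₂ (there m)) = contradiction (proj₂ (growth-hit-ends g (inj₂ m))) v∉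
    ... | no c≢v = growth-older-unique g (old ac c<a) (old bc c<b) (shifted ac c<a) (shifted bc c<b)
      where
      newest : index (v ∷ U) v ≡ 0
      newest = cong (if_then 0 else suc (index U v)) (dec-true (v ≟ v) refl)
      c< : ∀ {x} → suc (index U c) < index (v ∷ U) x → x ≢ v
      c< lt refl = contradiction (subst (suc (index U c) <_) newest lt) λ ()
      old : ∀ {x} → Hit ((u , v) ∷ F) x c → suc (index U c) < index (v ∷ U) x → Hit F x c
      old (inj₁ (here refl)) _ = contradiction refl c≢v
      old (inj₂ (here refl)) lt = contradiction refl (c< lt)
      old (inj₁ (there m)) _ = inj₁ m
      old (inj₂ (there m)) _ = inj₂ m
      shifted : ∀ {x} → Hit ((u , v) ∷ F) x c → suc (index U c) < index (v ∷ U) x → index U c < index U x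
      shifted _ lt = s≤s⁻¹ (subst (suc (index U c) <_) (index-later {U} (c< lt)) lt)

    growth-length : ∀ {U F} → Growth E r U F → length U ≤ n
    growth-length g = ≤-trans (unique-⊆-length {ys = allFin n} (growth-unique g) (λ {x} _ → ∈-allFin x))
                              (≤-reflexive (length-tabulate (λ x → x)))

  Closed : (V → V → Set) → List V → Set
  Closed E U = ∀ {u v} → u ∈ U → E u v → v ∈ U

  closed-star : ∀ {E U} → Closed E U → ∀ {u v} → u ∈ U → Star E u v → v ∈ U
  closed-star closed u∈ ε = u∈
  closed-star closed u∈ (e ◅ es) = closed-star closed (closed u∈ e) es

  saturate : ∀ {E} → (∀ u v → Dec (E u v)) → ∀ r → ∃[ U ] ∃[ F ] (Growth E r U F × Closed E U)
  -- The sum of `length U` and the fuel starts at n + 1 and stays constant. A growth has at most n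
  -- vertices, so it stops before the fuel is exhausted.
  saturate {E} E? r = go n root ≤-refl
    where
    go : ∀ {U F} fuel → Growth E r U F → n < length U + fuel → ∃[ U ] ∃[ F ] (Growth E r U F × Closed E U)
    go {U} {F} fuel g enough
      with any? (λ u → any? (λ v → (u ∈? U) ×-dec ¬? (v ∈? U) ×-dec E? u v))
    ... | no stuck = U , F , g , λ {u} {v} u∈ e →
            decidable-stable (v ∈? U) (λ v∉ → stuck (u , v , u∈ , v∉ , e))
    go {U} zero g enough | yes _ =
      contradiction (≤-trans enough (≤-reflexive (+-identityʳ (length U)))) (≤⇒≯ (growth-length g))
    go {U} (suc fuel) g enough | yes (u , v , u∈ , v∉ , e) =
      go fuel (grow g u∈ v∉ e) (≤-trans enough (≤-reflexive (+-suc (length U) fuel)))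

  -- In a walk without backtracking, once the height decreases it keeps decreasing, because no
  -- vertex has two higher neighbours.  Hence a closed walk leaves and re-enters its start through
  -- higher neighbours of it.
  module _ {E : V → V → Set} (h : V → ℕ)
    (h-distinct : ∀ {a b} → E a b → h a ≢ h b)
    (higher-unique : ∀ {a b c} → E a c → E c b → h c < h a → h c < h b → a ≡ b) where

    NonBacktracking : List V → Set
    NonBacktracking (a ∷ c ∷ b ∷ xs) = a ≢ b × NonBacktracking (c ∷ b ∷ xs)
    NonBacktracking _ = ⊤

    final : V → List V → V
    final x [] = x
    final _ (x ∷ xs) = final x xs

    final∈ : ∀ x xs → final x xs ∈ x ∷ xs
    final∈ x [] = here refl
    final∈ _ (x ∷ xs) = there (final∈ x xs)

    unique⇒nonBacktracking : ∀ {v} xs → Unique (v ∷ xs) → NonBacktracking (xs ++ v ∷ [])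
    unique⇒nonBacktracking [] _ = tt
    unique⇒nonBacktracking (_ ∷ []) _ = tt
    unique⇒nonBacktracking (_ ∷ _ ∷ []) ((v≢x ∷ _) ∷ _) = ≢-sym v≢x , tt
    unique⇒nonBacktracking (x ∷ y ∷ z ∷ xs) ((_ ∷ v≢) ∷ (_ ∷ x≢z ∷ _) ∷ uniq) =
      x≢z , unique⇒nonBacktracking (y ∷ z ∷ xs) (v≢ ∷ uniq)

    step : ∀ {a b} → E a b → h a < h b ⊎ h b < h a
    step {a} {b} e with <-cmp (h a) (h b)
    ... | tri< lt _ _ = inj₁ lt
    ... | tri≈ _ eq _ = contradiction eq (h-distinct e)
    ... | tri> _ _ gt = inj₂ gt

    descending : ∀ a c xs z → Linked E (a ∷ c ∷ xs ++ z ∷ []) → NonBacktracking (a ∷ c ∷ xs ++ z ∷ []) → h c < h a →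
      h z < h a × h z < h (final c xs)
    descending a c [] z (ac ∷ cz ∷ _) (a≢z , _) c<a = case step cz of λ where
      (inj₁ c<z) → contradiction (higher-unique ac cz c<a c<z) a≢z
      (inj₂ z<c) → <-trans z<c c<a , z<c
    descending a c (d ∷ xs) z (ac ∷ l@(cd ∷ _)) (a≢d , nb) c<a = case step cd of λ where
      (inj₁ c<d) → contradiction (higher-unique ac cd c<a c<d) a≢d
      (inj₂ d<c) → let z<c , z<last = descending c d xs z l nb d<c in <-trans z<c c<a , z<last

    rises-or-ends-descending : ∀ a xs z → Linked E (a ∷ xs ++ z ∷ []) → NonBacktracking (a ∷ xs ++ z ∷ []) →
      h a < h z ⊎ h z < h (final a xs)
    rises-or-ends-descending a [] z (az ∷ _) _ = step az
    rises-or-ends-descending a (c ∷ xs) z l@(ac ∷ l′) nb = case step ac of λ where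
        (inj₂ c<a) → inj₂ (proj₂ (descending a c xs z l nb c<a))
        (inj₁ a<c) → Sum.map₁ (<-trans a<c) (rises-or-ends-descending c xs z l′ (tail xs nb))
      where
      tail : ∀ xs → NonBacktracking (a ∷ c ∷ xs ++ z ∷ []) → NonBacktracking (c ∷ xs ++ z ∷ [])
      tail [] = proj₂
      tail (_ ∷ _) = proj₂

    no-cycle : (∀ {a b} → E a b → E b a) → ∀ v vs → 2 ≤ length vs → Unique (v ∷ vs) → ¬ Linked E (v ∷ vs ++ v ∷ [])
    no-cycle E-sym v (_ ∷ []) (s≤s ())
    no-cycle E-sym v vs@(x ∷ y ∷ xs) _ u@((_ ∷ v≢y ∷ _) ∷ (x≢ ∷ _)) l@(vx ∷ _) =
      case rises-or-ends-descending v vs v l nb of λ where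
        (inj₁ v<v) → <-irrefl refl v<v
        (inj₂ v<last) → case step vx of λ where
          (inj₂ x<v) → <-irrefl refl (proj₁ (descending v x (y ∷ xs) v l nb x<v))
          -- The first and the last vertex of `vs` are both higher neighbours of `v`, hence equal,
          -- although they are different entries of a list without repetitions.
          (inj₁ v<x) → All.lookup x≢ (final∈ y xs) (higher-unique (E-sym vx) (last-edge v vs l) v<x v<last)
      where
      nb = v≢y , unique⇒nonBacktracking vs u
      last-edge : ∀ a xs {z} → Linked E (a ∷ xs ++ z ∷ []) → E z (final a xs)
      last-edge a [] (e ∷ _) = E-sym e
      last-edge a (x ∷ xs) (_ ∷ l) = last-edge x xs l

  ∈-tabulate : ∀ {f : V → Bool} {v} → f v ≡ true → v ∈ˢ Vec.tabulate f
  ∈-tabulate {f} {v} eq = lookup⇒[]= v (Vec.tabulate f) (trans (lookup∘tabulate f v) eq)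

  tabulate-∈ : ∀ {f : V → Bool} {v} → v ∈ˢ Vec.tabulate f → f v ≡ true
  tabulate-∈ {f} {v} v∈ = trans (sym (lookup∘tabulate f v)) ([]=⇒lookup v∈)

  subset : List V → Subset n
  subset U = Vec.tabulate (λ v → does (v ∈? U))

  ∈⇒∈-subset : ∀ {U v} → v ∈ U → v ∈ˢ subset U
  ∈⇒∈-subset {U} {v} v∈ = ∈-tabulate (dec-true (v ∈? U) v∈)

  ∈-subset⇒∈ : ∀ {U v} → v ∈ˢ subset U → v ∈ U
  ∈-subset⇒∈ {U} {v} v∈ with v ∈? U | tabulate-∈ {f = λ v → does (v ∈? U)} v∈
  ... | yes v∈U | _ = v∈U
  ... | no _    | ()

  T-does⇒ : {P : Set} (P? : Dec P) → T (does P?) → P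
  T-does⇒ (yes p) _ = p

  ⇒T-does : {P : Set} (P? : Dec P) → P → T (does P?)
  ⇒T-does (yes _) _ = tt
  ⇒T-does (no ¬p) p = ¬p p

  growth-edges : ∀ {E r U F} → Growth E r U F → EdgeSet n
  growth-edges {F = F} g = record
    { mem = λ u v → does (hit? F u v)
    ; mem-sym = λ u v → does-⇔ (mk⇔ swap swap) (hit? F u v) (hit? F v u)
    ; mem-irrefl = λ u → dec-false (hit? F u u) [ (λ m → growth-loopless g m refl) , (λ m → growth-loopless g m refl) ]′
    }

  adj⇒hit : ∀ {E r U F u v} (g : Growth E r U F) → Adj (growth-edges g) u v → Hit F u v
  adj⇒hit {F = F} {u} {v} _ = T-does⇒ (hit? F u v)

  hit⇒adj : ∀ {E r U F u v} (g : Growth E r U F) → Hit F u v → Adj (growth-edges g) u v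
  hit⇒adj {F = F} {u} {v} _ = ⇒T-does (hit? F u v)

  -- With `index U` as height, older vertices are higher, and the only higher neighbour of a vertex
  -- is its parent.
  growth-acyclic : ∀ {E r U F} (g : Growth E r U F) → Acyclic (growth-edges g)
  growth-acyclic {U = U} {F} g v vs (2≤ , uniq , l) =
    no-cycle {E = Hit F} (index U)
      (λ e eq → let a∈ , _ = growth-hit-ends g e in loopless e (index-injective a∈ eq))
      (λ ac cb → growth-older-unique g ac (swap cb))
      swap v vs 2≤ uniq (Linked.map (adj⇒hit g) l)
    where
    loopless : ∀ {a b} → Hit F a b → a ≢ b
    loopless (inj₁ m) = growth-loopless g m
    loopless (inj₂ m) = ≢-sym (growth-loopless g m)

  adj-sym : (E : EdgeSet n) → ∀ {u v} → Adj E u v → Adj E v u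
  adj-sym E {u} {v} = subst T (EdgeSet.mem-sym E u v)

  adj? : (E : EdgeSet n) → ∀ u v → Dec (Adj E u v)
  adj? E u v = T? (EdgeSet.mem E u v)

  -- A colour class merely connects S and may contain cycles and further components. Growing from
  -- `r` keeps one component and one edge per new vertex.
  spanning-tree : (G : Graph n) (S : Subset n) (E : EdgeSet n) → E ⊆ᴱ edges G → ∀ {r} →
    (∀ {v} → v ∈ˢ S → Star (Adj E) r v) →
    Σ[ T ∈ TreeConnecting G S ] (edgeSet (subgraph T) ⊆ᴱ E)
  spanning-tree G S E E⊆G {r} reach with saturate (adj? E) r
  ... | U , F , g , closed = tree , ⊆E
    where
    ⊆E : growth-edges g ⊆ᴱ E
    ⊆E a = [ growth-edge g , adj-sym E ∘ growth-edge g ]′ (adj⇒hit g a)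
    tree : TreeConnecting G S
    tree = record
      { subgraph = record
        { vertexSet = subset U
        ; edgeSet = growth-edges g
        ; edge⊆ = E⊆G ∘ ⊆E
        ; endpoint = λ a → ∈⇒∈-subset (proj₁ (growth-hit-ends g (adj⇒hit g a)))
        }
      ; isTree =
          ((r , ∈⇒∈-subset (growth-root g)) , λ u∈ v∈ →
            to-root (∈-subset⇒∈ u∈) ◅◅ Star.reverse (adj-sym (growth-edges g)) (to-root (∈-subset⇒∈ v∈)))
          , growth-acyclic g
      ; connects = λ v∈ → ∈⇒∈-subset (closed-star closed (growth-root g) (reach v∈))
      }
      where
      to-root : ∀ {u} → u ∈ U → Star (Adj (growth-edges g)) u r
      to-root u∈ = Star.map (hit⇒adj g) (growth-linked g u∈)

-- Subsets as lists, and subsets of prescribed size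

elements : ∀ {n} → Subset n → List (Fin n)
elements Vec.[]           = []
elements (true Vec.∷ p)  = zero ∷ map suc (elements p)
elements (false Vec.∷ p) = map suc (elements p)

length-elements : ∀ {n} (p : Subset n) → length (elements p) ≡ ∣ p ∣
length-elements Vec.[]           = refl
length-elements (true Vec.∷ p)  = cong suc (trans (length-map suc (elements p)) (length-elements p))
length-elements (false Vec.∷ p) = trans (length-map suc (elements p)) (length-elements p)

elements-unique : ∀ {n} (p : Subset n) → Unique (elements p)
elements-unique Vec.[]           = []
elements-unique (true Vec.∷ p)  =
  All.tabulate (λ m → case ∈-map⁻ suc m of λ { (_ , _ , refl) () }) ∷ Unique.map⁺ Fin.suc-injective (elements-unique p)
elements-unique (false Vec.∷ p) = Unique.map⁺ Fin.suc-injective (elements-unique p)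

∈-elements⁺ : ∀ {n} {p : Subset n} {v} → v ∈ˢ p → v ∈ elements p
∈-elements⁺ {p = true Vec.∷ p}  Vec.here       = here refl
∈-elements⁺ {p = true Vec.∷ p}  (Vec.there v∈) = there (∈-map⁺ suc (∈-elements⁺ v∈))
∈-elements⁺ {p = false Vec.∷ p} (Vec.there v∈) = ∈-map⁺ suc (∈-elements⁺ v∈)

∈-elements⁻ : ∀ {n} {p : Subset n} {v} → v ∈ elements p → v ∈ˢ p
∈-elements⁻ {p = true Vec.∷ p}  (here refl) = Vec.here
∈-elements⁻ {p = true Vec.∷ p}  (there m) with ∈-map⁻ suc m
... | _ , v∈ , refl = Vec.there (∈-elements⁻ v∈)
∈-elements⁻ {p = false Vec.∷ p} m with ∈-map⁻ suc m
... | _ , v∈ , refl = Vec.there (∈-elements⁻ v∈)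

subset-of-size : ∀ {n} k (p : Subset n) → ∣ p ∣ ≤ k → k ≤ n → ∃[ s ] (∣ s ∣ ≡ k × p ⊆ˢ s)
subset-of-size zero Vec.[] _ _ = Vec.[] , refl , λ x → x
subset-of-size (suc k) (true Vec.∷ p) (s≤s p≤) (s≤s k≤) with subset-of-size k p p≤ k≤
... | s , eq , p⊆s = true Vec.∷ s , cong suc eq , λ { Vec.here → Vec.here ; (Vec.there x∈) → Vec.there (p⊆s x∈) }
subset-of-size {suc n} k (false Vec.∷ p) p≤ k≤ with k ≤? n
... | yes k≤n with subset-of-size k p p≤ k≤n
...   | s , eq , p⊆s = false Vec.∷ s , eq , λ { (Vec.there x∈) → Vec.there (p⊆s x∈) }
-- Now `k` equals `suc n`, so every vertex is taken, also the one that the given subset omits.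
subset-of-size {suc n} k (false Vec.∷ p) p≤ k≤ | no k≰n with ≤-antisym k≤ (≰⇒> k≰n)
... | refl with subset-of-size n p (∣p∣≤n p) ≤-refl
...   | s , eq , p⊆s = true Vec.∷ s , cong suc eq , λ { (Vec.there x∈) → Vec.there (p⊆s x∈) }

-- On k vertices, q = ⌊k/2⌋ disjoint spanning trees remain after deleting any p edges.
data Slack : ℕ → ℕ → ℕ → Set where
  even : ∀ {q} → Slack (q + q) q 0
  odd  : ∀ {q} → Slack (suc (q + q)) q q

slack< : ∀ {k q p} → Slack k q p → 3 ≤ k → suc p < k
slack< even 3≤k = ≤-trans (n≤1+n 2) 3≤k
slack< (odd {zero}) (s≤s ())
slack< (odd {suc q}) _ = s≤s (s≤s (≤-trans (m≤n+m (suc q) q) ≤-refl))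

-- From coloured packings to edge-disjoint trees

module _ {n : ℕ} where

  private
    V = Fin n

  open DecMembership (_≟_ {n}) using (_∈?_)

  edge-class : EdgeSet n → (C : V → V → ℕ) → (∀ u v → C u v ≡ C v u) → ℕ → EdgeSet n
  edge-class E C C-sym i = record
    { mem = λ u v → EdgeSet.mem E u v ∧ does (C u v ℕ.≟ i)
    ; mem-sym = λ u v → cong₂ _∧_ (EdgeSet.mem-sym E u v) (cong (λ c → does (c ℕ.≟ i)) (C-sym u v))
    ; mem-irrefl = λ u → cong (_∧ does (C u u ℕ.≟ i)) (EdgeSet.mem-irrefl E u)
    }

  packing⇒trees : ∀ {A L N t} (G : Graph n) (S : Subset n) {r} → (∀ {v} → v ∈ˢ S → v ∈ L) → r ∈ˢ S →
    (∀ {u v} → u ≢ v → ¬ Adj (edges G) u v → Hit N u v) → Packing A L N t → EdgeDisjointTrees G S t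
  packing⇒trees {A} {L} {N} {t} G S {r} S⊆L r∈S cover P = (λ i → proj₁ (tree i)) , disjoint
    where
    open Packing P
    class : Fin t → EdgeSet n
    class i = edge-class (edges G) colour colour-sym (toℕ i)
    link⇒adj : ∀ i {u v} → Link A N colour (toℕ i) u v → Adj (class i) u v
    link⇒adj i {u} {v} (link _ _ u≢v free col) = Equivalence.from T-∧
      ( decidable-stable (adj? (edges G) u v) (λ ¬e → free (cover u≢v ¬e))
      , ⇒T-does {n} (colour u v ℕ.≟ toℕ i) col)
    class⇒adj : ∀ i {u v} → Adj (class i) u v → Adj (edges G) u v × colour u v ≡ toℕ i
    class⇒adj i {u} {v} a = let e , c = Equivalence.to T-∧ a in e , T-does⇒ {n} (colour u v ℕ.≟ toℕ i) c
    tree : ∀ i → Σ[ T ∈ TreeConnecting G S ] (edgeSet (subgraph T) ⊆ᴱ class i)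
    tree i = spanning-tree G S (class i) (proj₁ ∘ class⇒adj i) (λ v∈ →
      Star.map (link⇒adj i) (linked (toℕ<n i) (S⊆L r∈S) (S⊆L v∈)))
    disjoint : ∀ i j → i ≢ j → EdgeDisjoint (edgeSet (subgraph (proj₁ (tree i)))) (edgeSet (subgraph (proj₁ (tree j))))
    disjoint i j i≢j (a , b) = i≢j (toℕ-injective
      (trans (sym (proj₂ (class⇒adj i (proj₂ (tree i) a)))) (proj₂ (class⇒adj j (proj₂ (tree j) b)))))

  slack-packing : ∀ {k q p} → Slack k q p → (L : List V) → Unique L → length L ≡ k →
    ∀ M → length M ≤ p → Packing L L M q
  slack-packing {q = q} even L uL ∣L∣ [] _ = even-packing q L uL ∣L∣
  slack-packing {q = q} odd  L uL ∣L∣ M ∣M∣ = odd-packing q L M uL ∣L∣ ∣M∣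

  trees-exist : ∀ {k q p} → Slack k q p → 3 ≤ k → (G : Graph n) (S : Subset n) → ∣ S ∣ ≡ k →
    ∀ N → length N ≤ p → (∀ {u v} → u ≢ v → ¬ Adj (edges G) u v → Hit N u v) →
    EdgeDisjointTrees G S (length (elements (∁ S)) + q)
  trees-exist {k} slack 3≤k G S ∣S∣ N ∣N∣ cover =
    packing⇒trees G S ∈-elements⁺
      (∈-elements⁻ (proj₂ (inhabited L (≤-trans (≤-trans (s≤s z≤n) 3≤k) (≤-reflexive (sym ∣L∣)))))) cover
      (packing-add-vertices L (elements-unique S) (≤-trans (slack< slack 3≤k) (≤-reflexive (sym ∣L∣)))
        (slack-packing slack L (elements-unique S) ∣L∣)
        (elements (∁ S)) (elements-unique (∁ S))
        (λ w∈ v∈ → x∈∁p⇒x∉p (∈-elements⁻ {p = ∁ S} w∈) (∈-elements⁻ v∈)) N ∣N∣)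
    where
    L = elements S
    ∣L∣ : length L ≡ k
    ∣L∣ = trans (length-elements S) ∣S∣

  -- Unordered pairs, and the edges of a tree that meet S

  -- A canonical orientation for counting: uniqueness of `map norm F` excludes that `F` lists an
  -- edge twice, even in opposite directions.
  norm : V × V → V × V
  norm (u , v) = if does (u Fin.≤? v) then (u , v) else (v , u)

  norm-≤ : ∀ {u v} → u Fin.≤ v → norm (u , v) ≡ (u , v)
  norm-≤ {u} {v} u≤v = cong (if_then (u , v) else (v , u)) (dec-true (u Fin.≤? v) u≤v)

  norm-≰ : ∀ {u v} → ¬ u Fin.≤ v → norm (u , v) ≡ (v , u)
  norm-≰ {u} {v} u≰v = cong (if_then (u , v) else (v , u)) (dec-false (u Fin.≤? v) u≰v)

  norm-swap : ∀ u v → norm (u , v) ≡ norm (v , u)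
  norm-swap u v = case ((u Fin.≤? v) ,′ (v Fin.≤? u)) of λ where
    (yes u≤v , yes v≤u) → cong₂ (λ a b → norm (a , b)) (Fin.≤-antisym u≤v v≤u) (Fin.≤-antisym v≤u u≤v)
    (yes u≤v , no v≰u)  → trans (norm-≤ u≤v) (sym (norm-≰ v≰u))
    (no u≰v , yes v≤u)  → trans (norm-≰ u≰v) (sym (norm-≤ v≤u))
    (no u≰v , no v≰u)   → contradiction (Fin.≤-total u v) [ u≰v , v≰u ]′

  norm-cases : ∀ u v → norm (u , v) ≡ (u , v) ⊎ norm (u , v) ≡ (v , u)
  norm-cases u v with does (u Fin.≤? v)
  ... | true  = inj₁ refl
  ... | false = inj₂ refl

  norm-injective : ∀ {a b u v} → norm (a , b) ≡ norm (u , v) → (a ≡ u × b ≡ v) ⊎ (a ≡ v × b ≡ u)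
  norm-injective {a} {b} {u} {v} eq with norm-cases a b | norm-cases u v
  ... | inj₁ p | inj₁ q = inj₁ (,-injective (trans (sym p) (trans eq q)))
  ... | inj₁ p | inj₂ q = inj₂ (,-injective (trans (sym p) (trans eq q)))
  ... | inj₂ p | inj₁ q = inj₂ (Product.swap (,-injective (trans (sym p) (trans eq q))))
  ... | inj₂ p | inj₂ q = inj₁ (Product.swap (,-injective (trans (sym p) (trans eq q))))

  adj-norm : (E : EdgeSet n) → ∀ {a b u v} → norm (a , b) ≡ norm (u , v) → Adj E a b → Adj E u v
  adj-norm E eq e with norm-injective eq
  ... | inj₁ (refl , refl) = e
  ... | inj₂ (refl , refl) = adj-sym E e

  pairs : List V → List (V × V)
  pairs []       = []
  pairs (x ∷ xs) = map (x ,_) xs ++ pairs xs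

  pairs-cover : ∀ {xs u v} → u ∈ xs → v ∈ xs → u ≢ v → Hit (pairs xs) u v
  pairs-cover (here refl) (here refl) u≢v = contradiction refl u≢v
  pairs-cover (here refl) (there v∈) _ = inj₁ (∈-++⁺ˡ (∈-map⁺ _ v∈))
  pairs-cover (there u∈) (here refl) _ = inj₂ (∈-++⁺ˡ (∈-map⁺ _ u∈))
  pairs-cover {x ∷ xs} (there u∈) (there v∈) u≢v = hit-++ʳ (map (x ,_) xs) (pairs-cover u∈ v∈ u≢v)

  -- Binomial coefficient of the length over 2, in a form free of division and subtraction;
  -- `inner-bound` starts from this equation.
  length-pairs : ∀ xs → length (pairs xs) + length (pairs xs) + length xs ≡ length xs * length xs
  length-pairs [] = refl
  length-pairs (x ∷ xs) = trans
    (cong (λ c → c + c + suc (length xs))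
      (trans (length-++ (map (x ,_) xs)) (cong (_+ length (pairs xs)) (length-map (x ,_) xs))))
    (trans (expand (length xs) (length (pairs xs)))
    (trans (cong (λ s → s + length xs + length xs + 1) (length-pairs xs)) (square (length xs))))
    where
    expand : ∀ l c → l + c + (l + c) + suc l ≡ c + c + l + l + l + 1
    expand = solve-∀
    square : ∀ l → l * l + l + l + 1 ≡ suc l * suc l
    square = solve-∀

  hit⇒norm∈ : ∀ {M u v} → Hit M u v → norm (u , v) ∈ map norm M
  hit⇒norm∈ (inj₁ m) = ∈-map⁺ norm m
  hit⇒norm∈ {M} {u} {v} (inj₂ m) = subst (_∈ map norm M) (norm-swap v u) (∈-map⁺ norm m)

  growth-norm-unique : ∀ {E r U F} → Growth E r U F → Unique (map norm F)
  growth-norm-unique root = []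
  growth-norm-unique {F = (u , v) ∷ F} (grow g _ v∉ _) = All.tabulate fresh ∷ growth-norm-unique g
    where
    fresh : ∀ {e} → e ∈ map norm F → norm (u , v) ≢ e
    fresh e∈ eq with ∈-map⁻ norm e∈
    ... | _ , m , refl with norm-injective eq
    ...   | inj₁ (refl , refl) = v∉ (proj₂ (growth-ends g m))
    ...   | inj₂ (refl , refl) = v∉ (proj₁ (growth-ends g m))

  -- Pairs are oriented from parent to child, and the child lies in `L`. The alternatives of `count`
  -- belong to a tree with a vertex outside `L` and to a tree within `L`.
  record EdgesAt (E : EdgeSet n) (L : List V) : Set where
    field
      list  : List (V × V)
      uniq  : Unique (map norm list)
      adj   : ∀ {u v} → (u , v) ∈ list → Adj E u v × v ∈ L
      count : length L ≤ length list ⊎ (length L ≤ suc (length list) × (∀ {u v} → (u , v) ∈ list → u ∈ L))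

  -- If the tree has a vertex outside S, it is rooted there, and every vertex of S is the child of
  -- an edge of its own. Otherwise the root lies in S and is the only vertex of S without such an
  -- edge, and all edges stay inside S.
  edges-at : ∀ {G} {S : Subset n} (T : TreeConnecting G S) {s} → s ∈ˢ S → EdgesAt (edgeSet (subgraph T)) (elements S)
  edges-at {S = S} T {s} s∈S = case any? (λ w → (w ∈ˢ? VT) ×-dec ¬? (w ∈ˢ? S)) of λ where
      (yes (w , w∈ , w∉)) → from w∈ λ (F , children) →
        inj₁ (≤-trans (unique-⊆-length (elements-unique S) λ x∈ →
                [ (λ { refl → contradiction (∈-elements⁻ x∈) w∉ }) , (λ m → m) ]′ (children x∈))
              (≤-reflexive (length-map proj₂ F)))
      (no none) → from (connects T s∈S) λ (F , children) →
        inj₂ ((≤-trans (unique-⊆-length {ys = s ∷ map proj₂ F} (elements-unique S) λ x∈ →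
                 [ here , there ]′ (children x∈))
               (s≤s (≤-reflexive (length-map proj₂ F)))) ,
              λ {u} e → ∈-elements⁺ (decidable-stable (u ∈ˢ? S) λ u∉ → none (u , endpoint (subgraph T) e , u∉)))
    where
    E = edgeSet (subgraph T)
    VT = vertexSet (subgraph T)
    L = elements S
    at? : Decidable (λ (e : V × V) → proj₂ e ∈ L)
    at? (_ , v) = v ∈? L
    from : ∀ {w} → w ∈ˢ VT →
      (((F , _) : ∃[ F ] (∀ {x} → x ∈ L → x ≡ w ⊎ x ∈ map proj₂ F)) →
        length L ≤ length F ⊎ (length L ≤ suc (length F) × (∀ {u v} → Adj E u v → u ∈ L))) → EdgesAt E L
    from {w} w∈ enough with saturate (adj? E) w
    ... | U , F , g , closed = record
      { list = filter at? F
      ; uniq = AllPairs.map⁺ (AllPairs.filter⁺ at? (AllPairs.map⁻ (growth-norm-unique g)))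
      ; adj = λ m → let m∈F , v∈ = ∈-filter⁻ at? {xs = F} m in growth-edge g m∈F , v∈
      ; count = Sum.map₂ (Product.map₂ λ inside m →
          inside (growth-edge g (proj₁ (∈-filter⁻ at? {xs = F} m)))) (enough (filter at? F , children))
      }
      where
      children : ∀ {x} → x ∈ L → x ≡ w ⊎ x ∈ map proj₂ (filter at? F)
      children x∈ = Sum.map₂ keep (growth-parent g
        (closed-star closed (growth-root g) (proj₂ (proj₁ (isTree T)) w∈ (connects T (∈-elements⁻ x∈)))))
        where
        keep : _ → _
        keep m with ∈-map⁻ proj₂ m
        ... | (u , v) , m∈F , refl = ∈-map⁺ proj₂ (∈-filter⁺ at? m∈F x∈)

  size-subset : (vs : List V) → ∣ subset vs ∣ ≤ length vs
  size-subset vs = ≤-trans (≤-reflexive (sym (length-elements (subset vs))))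
    (unique-⊆-length {ys = vs} (elements-unique (subset vs)) (∈-subset⇒∈ ∘ ∈-elements⁻))

-- Counting the edges of disjoint trees

length-cartesianProduct : ∀ {Y : Set} (xs : List X) (ys : List Y) → length (cartesianProduct xs ys) ≡ length xs * length ys
length-cartesianProduct [] ys = refl
length-cartesianProduct (x ∷ xs) ys =
  trans (length-++ (map (x ,_) ys)) (cong₂ _+_ (length-map (x ,_) ys) (length-cartesianProduct xs ys))

length-concat-tabulate : ∀ {j} (f : Fin j → List X) → length (concat (tabulate f)) ≡ sum (tabulate (length ∘ f))
length-concat-tabulate {j = zero}  f = refl
length-concat-tabulate {j = suc j} f = trans (length-++ (f zero)) (cong (length (f zero) +_) (length-concat-tabulate (f ∘ suc)))

sum-tabulate-≥ : ∀ {j k} {a b : Fin j → ℕ} → (∀ i → k ≤ a i + b i) → j * k ≤ sum (tabulate a) + sum (tabulate b)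
sum-tabulate-≥ {zero} _ = z≤n
sum-tabulate-≥ {suc j} {k} {a} {b} k≤ = ≤-trans (+-mono-≤ (k≤ zero) (sum-tabulate-≥ (k≤ ∘ suc)))
  (≤-reflexive (interchange (a zero) (b zero) (sum (tabulate (a ∘ suc))) (sum (tabulate (b ∘ suc)))))
  where
  interchange : ∀ x y z w → x + y + (z + w) ≡ x + z + (y + w)
  interchange = solve-∀

sum-tabulate-*-≤ : ∀ {j c} {a b : Fin j → ℕ} → (∀ i → b i * c ≤ a i) → sum (tabulate b) * c ≤ sum (tabulate a)
sum-tabulate-*-≤ {zero} _ = z≤n
sum-tabulate-*-≤ {suc j} {c} {a} {b} b≤ = ≤-trans (≤-reflexive (ℕ.*-distribʳ-+ c (b zero) _))
  (+-mono-≤ (b≤ zero) (sum-tabulate-*-≤ (b≤ ∘ suc)))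

double-injective : ∀ {a b} → a + a ≡ b + b → a ≡ b
double-injective {a} {b} eq = ℕ.*-cancelˡ-≡ a b 2 (trans (double a) (trans eq (sym (double b))))
  where
  double : ∀ x → 2 * x ≡ x + x
  double = solve-∀

-- Here c is the number of pairs in S and t the number of trees inside S; in both cases t ≤ q. For k
-- = 2q, c = q(k - 1), so the sum is at most qk. For k = 2q + 1, c = qk already, and t contributes
-- the excess p = q.
inner-bound : ∀ {k q p c t} → Slack k q p → 3 ≤ k → c + c + k ≡ k * k → t * (k ∸ 1) ≤ c → c + t ≤ q * k + p
inner-bound {c = c} {t} (even {suc q}) _ 2c t≤ = subst (λ x → x + t ≤ suc q * (suc q + suc q) + 0) (sym c≡)
  (≤-trans (+-monoʳ-≤ _ t≤q) (≤-reflexive (total q)))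
  where
  twice : ∀ q → suc q * suc (q + q) + suc q * suc (q + q) + (suc q + suc q) ≡ (suc q + suc q) * (suc q + suc q)
  twice = solve-∀
  total : ∀ q → suc q * suc (q + q) + suc q ≡ suc q * (suc q + suc q) + 0
  total = solve-∀
  c≡ : c ≡ suc q * suc (q + q)
  c≡ = double-injective (ℕ.+-cancelʳ-≡ (suc q + suc q) _ _ (trans 2c (sym (twice q))))
  t≤q : t ≤ suc q
  t≤q = ℕ.*-cancelʳ-≤ t (suc q) (suc (q + q)) (subst₂ (λ x y → t * x ≤ y) (+-suc q q) c≡ t≤)
inner-bound (odd {zero}) (s≤s ())
inner-bound {c = c} {t} (odd {suc q}) _ 2c t≤ = subst (λ x → x + t ≤ suc q * suc (suc q + suc q) + suc q) (sym c≡)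
  (+-monoʳ-≤ _ (s≤s⁻¹ t<))
  where
  r = suc q
  twice : ∀ r → r * suc (r + r) + r * suc (r + r) + suc (r + r) ≡ suc (r + r) * suc (r + r)
  twice = solve-∀
  c≡ : c ≡ r * suc (r + r)
  c≡ = double-injective (ℕ.+-cancelʳ-≡ (suc (r + r)) _ _ (trans 2c (sym (twice r))))
  t< : t < suc r
  t< = ℕ.*-cancelʳ-< (r + r) t (suc r)
         (≤-trans (s≤s (≤-trans t≤ (≤-reflexive (trans c≡ (ℕ.*-suc r (r + r))))))
                  (+-monoˡ-≤ (r * (r + r)) (ℕ.m<m+n r (s≤s z≤n))))

-- The letters stand for j trees with s listed edges in all, t of these trees inside S, μ missing
-- edges at S, and w vertices outside S. A tree inside S may list one edge less than k, which t
-- makes up for.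
double-count : ∀ {k q p c t j s μ w} → Slack k q p → 3 ≤ k → c + c + k ≡ k * k → t * (k ∸ 1) ≤ c →
  j * k ≤ s + t → s + μ ≤ c + k * w → j * k + μ ≤ (w + q) * k + p
double-count {k} {q} {p} {c} {t} {j} {s} {μ} {w} slack 3≤k 2c t≤ jk≤ s+μ≤ = begin
  j * k + μ             ≤⟨ +-monoˡ-≤ μ jk≤ ⟩
  s + t + μ             ≡⟨ swap-last s t μ ⟩
  s + μ + t             ≤⟨ +-monoˡ-≤ t s+μ≤ ⟩
  c + k * w + t         ≡⟨ swap-last c (k * w) t ⟩
  c + t + k * w         ≤⟨ +-monoˡ-≤ (k * w) (inner-bound slack 3≤k 2c t≤) ⟩
  q * k + p + k * w     ≡⟨ collect q k p w ⟩
  (w + q) * k + p       ∎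
  where
  open ℕ.≤-Reasoning
  swap-last : ∀ x y z → x + y + z ≡ x + z + y
  swap-last = solve-∀
  collect : ∀ q k p w → q * k + p + k * w ≡ (w + q) * k + p
  collect = solve-∀

module _ {n : ℕ} where

  private
    V = Fin n

  -- A subgraph inside L has |L| - 1 edges among the pairs of L, so there are at most ⌊|L|/2⌋ of
  -- them; the others use at least |L| of the pairs that meet L.
  edges-bound : ∀ {k q p j} → Slack k q p → 3 ≤ k → (G : EdgeSet n) (L W : List V) → length L ≡ k →
    (∀ v → v ∈ L ⊎ v ∈ W) → (E : Fin j → EdgeSet n) → (∀ i → E i ⊆ᴱ G) →
    (∀ i i′ → i ≢ i′ → EdgeDisjoint (E i) (E i′)) → (∀ i → EdgesAt (E i) L) →
    (N : List (V × V)) → Unique (map norm N) → (∀ {u v} → (u , v) ∈ N → u ≢ v × ¬ Adj G u v × u ∈ L) →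
    j * k + length N ≤ (length W + q) * k + p
  edges-bound {k} {q} {p} {j} slack 3≤k G L W ∣L∣ L∪W E E⊆G disjoint at N uN missing =
    double-count {t = sum (tabulate extra)} {j = j} {s = sum (tabulate (length ∘ outer))} {μ = length N} slack 3≤k
      (subst (λ l → length (pairs L) + length (pairs L) + l ≡ l * l) ∣L∣ (length-pairs L))
      (≤-trans (sum-tabulate-*-≤ {a = length ∘ inner} {b = extra} inner-count)
        (≤-trans (≤-reflexive (sym (length-concat-tabulate inner)))
        (≤-trans (unique-⊆-length inner-unique inner⊆) (≤-reflexive (length-map norm (pairs L))))))
      (sum-tabulate-≥ {a = length ∘ outer} {b = extra} outer-count)
      (≤-trans (≤-reflexive (sym (trans (length-++ (concat (tabulate outer)))
                                        (cong₂ _+_ (length-concat-tabulate outer) (length-map norm N)))))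
        (≤-trans (unique-⊆-length all-unique all⊆)
        (≤-reflexive (trans (length-map norm P) (trans (length-++ (pairs L))
          (cong (length (pairs L) +_) (trans (length-cartesianProduct L W) (cong (_* length W) ∣L∣))))))))
    where
    P = pairs L ++ cartesianProduct L W
    module At i = EdgesAt (at i)

    -- `outer` contains all listed edges of a tree, whichever kind it is. For a tree within `L`,
    -- `extra` supplies the one edge it may lack and `inner` repeats its list, to be compared with
    -- `pairs L`; for the other trees both are trivial.
    outer : Fin j → List (V × V)
    outer i = map norm (At.list i)
    extra : Fin j → ℕ
    extra i = [ const 0 , const 1 ]′ (At.count i)
    inner : Fin j → List (V × V)
    inner i = [ const [] , const (outer i) ]′ (At.count i)

    outer-count : ∀ i → k ≤ length (outer i) + extra i
    outer-count i = subst₂ (λ l o → l ≤ o + extra i) ∣L∣ (sym (length-map norm (At.list i))) count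
      where
      count : length L ≤ length (At.list i) + extra i
      count with At.count i
      ... | inj₁ le = ≤-trans le (m≤m+n _ 0)
      ... | inj₂ (le , _) = ≤-trans le (≤-reflexive (+-comm 1 _))

    inner-count : ∀ i → extra i * (k ∸ 1) ≤ length (inner i)
    inner-count i with At.count i
    ... | inj₁ _ = z≤n
    ... | inj₂ (le , _) = ≤-trans (≤-reflexive (+-identityʳ (k ∸ 1)))
      (≤-trans (ℕ.∸-monoˡ-≤ 1 (≤-trans (≤-reflexive (sym ∣L∣)) le)) (≤-reflexive (sym (length-map norm (At.list i)))))

    outer-disjoint : ∀ {i i′} → i ≢ i′ → Disjoint (outer i) (outer i′)
    outer-disjoint {i} {i′} i≢i′ (e∈ , e∈′) with ∈-map⁻ norm e∈ | ∈-map⁻ norm e∈′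
    ... | (u , v) , m , refl | (u′ , v′) , m′ , eq =
      disjoint i i′ i≢i′ (proj₁ (At.adj i m) , adj-norm (E i′) (sym eq) (proj₁ (At.adj i′ m′)))

    inner⊆outer : ∀ {i e} → e ∈ inner i → e ∈ outer i
    inner⊆outer {i} e∈ with At.count i
    inner⊆outer () | inj₁ _
    ... | inj₂ _ = e∈

    inner-uniq : ∀ i → Unique (inner i)
    inner-uniq i with At.count i
    ... | inj₁ _ = []
    ... | inj₂ _ = At.uniq i

    inner-unique : Unique (concat (tabulate inner))
    inner-unique = Unique.concat⁺ (AllP.tabulate⁺ inner-uniq)
      (AllPairs.tabulate⁺ λ i≢i′ (a , b) → outer-disjoint i≢i′ (inner⊆outer a , inner⊆outer b))

    loopless : (E : EdgeSet n) → ∀ {u v} → Adj E u v → u ≢ v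
    loopless E a refl = subst T (EdgeSet.mem-irrefl E _) a

    inner⊆ : ∀ {e} → e ∈ concat (tabulate inner) → e ∈ map norm (pairs L)
    inner⊆ e∈ with ∈-concat⁻′ (tabulate inner) e∈
    ... | _ , e∈xs , xs∈ with ∈-tabulate⁻ xs∈
    ...   | i , refl with At.count i
    inner⊆ e∈ | _ , () , _ | i , refl | inj₁ _
    ...     | inj₂ (_ , left) with ∈-map⁻ norm e∈xs
    ...       | _ , m , refl = let a , v∈ = At.adj i m in
                 hit⇒norm∈ (pairs-cover (left m) v∈ (loopless (E i) a))

    meets-L : ∀ {u v} → u ∈ L → u ≢ v → norm (u , v) ∈ map norm P
    meets-L {u} {v} u∈ u≢v with L∪W v
    ... | inj₁ v∈L = hit⇒norm∈ (hit-++ˡ (pairs-cover u∈ v∈L u≢v))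
    ... | inj₂ v∈W = ∈-map⁺ norm (∈-++⁺ʳ (pairs L) (∈-cartesianProduct⁺ u∈ v∈W))

    in-tree : ∀ {e} → e ∈ concat (tabulate outer) → ∃[ i ] ∃[ u ] ∃[ v ] ((u , v) ∈ At.list i × e ≡ norm (u , v))
    in-tree e∈ with ∈-concat⁻′ (tabulate outer) e∈
    ... | _ , e∈xs , xs∈ with ∈-tabulate⁻ xs∈
    ...   | i , refl with ∈-map⁻ norm e∈xs
    ...     | (u , v) , m , eq = i , u , v , m , eq

    all⊆ : ∀ {e} → e ∈ concat (tabulate outer) ++ map norm N → e ∈ map norm P
    all⊆ e∈ with ∈-++⁻ (concat (tabulate outer)) e∈
    ... | inj₁ e∈T with in-tree e∈T
    ...   | i , u , v , m , refl = let a , v∈ = At.adj i m in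
              subst (_∈ map norm P) (norm-swap v u) (meets-L v∈ (≢-sym (loopless (E i) a)))
    all⊆ e∈ | inj₂ e∈N with ∈-map⁻ norm e∈N
    ...   | (u , v) , m , refl = let u≢v , _ , u∈L = missing m in meets-L u∈L u≢v

    all-unique : Unique (concat (tabulate outer) ++ map norm N)
    all-unique = Unique.++⁺
      (Unique.concat⁺ (AllP.tabulate⁺ At.uniq) (AllPairs.tabulate⁺ outer-disjoint)) uN λ (e∈T , e∈N) →
        case (in-tree e∈T ,′ ∈-map⁻ norm e∈N) of λ where
          ((i , u , v , m , eq) , ((u′ , v′) , m′ , eq′)) → proj₁ (proj₂ (missing m′))
            (adj-norm G (trans (sym eq) eq′) (E⊆G i (proj₁ (At.adj i m))))

  trees-bound : ∀ {k q p j} → Slack k q p → 3 ≤ k → (G : Graph n) (S : Subset n) → ∣ S ∣ ≡ k →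
    EdgeDisjointTrees G S j → (N : List (V × V)) → Unique (map norm N) →
    (∀ {u v} → (u , v) ∈ N → u ≢ v × ¬ Adj (edges G) u v × u ∈ˢ S) →
    j * k + length N ≤ (length (elements (∁ S)) + q) * k + p
  trees-bound {k} slack 3≤k G S ∣S∣ (T , disjoint) N uN missing =
    edges-bound slack 3≤k (edges G) (elements S) (elements (∁ S)) ∣L∣ cover
      (λ i → edgeSet (subgraph (T i))) (λ i → edge⊆ (subgraph (T i))) disjoint
      (λ i → edges-at (T i) (∈-elements⁻ (proj₂ (inhabited (elements S) (≤-trans (≤-trans (s≤s z≤n) 3≤k) (≤-reflexive (sym ∣L∣)))))))
      N uN (λ m → let u≢v , free , u∈S = missing m in u≢v , free , ∈-elements⁺ u∈S)
    where
    ∣L∣ : length (elements S) ≡ k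
    ∣L∣ = trans (length-elements S) ∣S∣
    cover : ∀ v → v ∈ elements S ⊎ v ∈ elements (∁ S)
    cover v with v ∈ˢ? S
    ... | yes v∈ = inj₁ (∈-elements⁺ v∈)
    ... | no v∉ = inj₂ (∈-elements⁺ (x∉p⇒x∈∁p v∉))

  -- The list from the definition of `∣_∣ᴱ`, so that its length is the size of the edge set by
  -- computation.
  edge-list : EdgeSet n → List (V × V)
  edge-list E = filterᵇ (λ (u , v) → (toℕ u <ᵇ toℕ v) ∧ EdgeSet.mem E u v) (cartesianProduct (allFin n) (allFin n))

  ∈-edge-list⁻ : ∀ E {u v} → (u , v) ∈ edge-list E → u Fin.< v × Adj E u v
  ∈-edge-list⁻ E {u} {v} m with Equivalence.to T-∧ (proj₂ (∈-filter⁻ (T? ∘ λ (u , v) → (toℕ u <ᵇ toℕ v) ∧ EdgeSet.mem E u v)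
                                   {xs = cartesianProduct (allFin n) (allFin n)} m))
  ... | lt , a = ℕ.<ᵇ⇒< (toℕ u) (toℕ v) lt , a

  edge-list-cover : ∀ E {u v} → Adj E u v → Hit (edge-list E) u v
  edge-list-cover E {u} {v} a = case Fin.<-cmp u v of λ where
      (tri< u<v _ _) → inj₁ (listed u<v a)
      (tri≈ _ refl _) → contradiction a (subst T (EdgeSet.mem-irrefl E u))
      (tri> _ _ v<u) → inj₂ (listed v<u (adj-sym E a))
    where
    listed : ∀ {u v} → u Fin.< v → Adj E u v → (u , v) ∈ edge-list E
    listed u<v a = ∈-filter⁺ (T? ∘ _) (∈-cartesianProduct⁺ (∈-allFin _) (∈-allFin _))
      (Equivalence.from T-∧ (ℕ.<⇒<ᵇ u<v , a))

  edge-list-norm : ∀ E → Unique (map norm (edge-list E))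
  edge-list-norm E = subst Unique
    (sym (map-id-local (All.tabulate λ m → norm-≤ (ℕ.<⇒≤ (proj₁ (∈-edge-list⁻ E m))))))
    (Unique.filter⁺ (T? ∘ _) (Unique.cartesianProduct⁺ (Unique.allFin⁺ n) (Unique.allFin⁺ n)))

-- Parity, rounding and maxima

slack-∃ : ∀ k → ∃[ q ] ∃[ p ] Slack k q p
slack-∃ zero = 0 , 0 , even
slack-∃ (suc k) with slack-∃ k
... | q , _ , even = q , q , odd
... | q , _ , odd  = suc q , 0 , subst (λ k → Slack k (suc q) 0) (cong suc (+-suc q q)) even

-- The left side is what the construction delivers: one tree for each vertex outside S and q trees
-- inside.
slack-order : ∀ {k q p} n → Slack k q p → k ≤ n → (n ∸ k) + q ≡ n ∸ ⌈ k /2⌉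
slack-order {k} {q} n slack k≤n = trans (sym (shifted slack)) (cong (_∸ ⌈ k /2⌉) (ℕ.m+[n∸m]≡n k≤n))
  where
  d = n ∸ k
  shifted : ∀ {k q p} → Slack k q p → (k + d) ∸ ⌈ k /2⌉ ≡ d + q
  shifted (even {q}) rewrite sym (ℕ.n≡⌈n+n/2⌉ q) | +-assoc q q d = trans (m+n∸m≡n q (q + d)) (+-comm q d)
  shifted (odd {q}) rewrite sym (ℕ.n≡⌊n+n/2⌋ q) | +-assoc q q d = trans (m+n∸m≡n q (q + d)) (+-comm q d)

double≡*2 : ∀ q → q + q ≡ q * 2
double≡*2 = solve-∀

odd-not-even : ∀ q → ¬ 2 ∣ suc (q + q)
odd-not-even q 2∣ with ∣⇒≤ (∣m+n∣m⇒∣n (subst (2 ∣_) (+-comm 1 (q + q)) 2∣) (divides q (double≡*2 q)))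
... | s≤s ()

-- No decision procedure for `P` is assumed. Refuting that a solution is the maximum produces a
-- larger one, and the bound `b` stops this after finitely many rounds.
¬¬-maximum : ∀ {P : ℕ → Set} b i → P i → (∀ {j} → P j → j < b) → ¬ ¬ (∃[ j ] IsMaximum P j)
¬¬-maximum {P} b i Pi bound none = go b i Pi (m≤n+m b i)
  where
  go : ∀ d i → P i → b ≤ i + d → ⊥
  go zero    i Pi b≤ = <-irrefl refl (≤-trans (bound Pi) (≤-trans b≤ (≤-reflexive (+-identityʳ i))))
  go (suc d) i Pi b≤ = none (i , Pi , λ j Pj → case j ≤? i of λ where
    (yes j≤i) → j≤i
    (no j≰i) → ⊥-elim (go d j Pj (≤-trans b≤ (≤-trans (≤-reflexive (+-suc i d)) (+-monoˡ-≤ d (≰⇒> j≰i))))))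

-- The two implications

module _ {n : ℕ} (G : Graph n) where

  private
    V = Fin n
    module Γ = EdgeSet (edges G)

  NonEdgeCover : List (V × V) → Set
  NonEdgeCover N = ∀ {u v} → u ≢ v → ¬ Adj (edges G) u v → Hit N u v

  adj-K : ∀ {u v : V} → u ≢ v → Adj (edges (K n)) u v
  adj-K {u} {v} u≢v with u ≟ v
  ... | yes u≡v = u≢v u≡v
  ... | no _    = tt

  iso-nonadjacent : ∀ {H} (iso : G ≅ H) → let π = _≅_.bijection iso in ∀ {u v} → u ≢ v → ¬ Adj (edges G) u v →
    π ⟨$⟩ʳ u ≢ π ⟨$⟩ʳ v × ¬ Adj (edges H) (π ⟨$⟩ʳ u) (π ⟨$⟩ʳ v)
  iso-nonadjacent iso {u} {v} u≢v ¬adj =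
    (λ eq → u≢v (trans (sym (inverseˡ bijection)) (trans (cong (bijection ⟨$⟩ˡ_) eq) (inverseˡ bijection)))) ,
    (λ a → ¬adj (subst T (adj-cong u v) a))
    where open _≅_ iso

  iso-K-cover : G ≅ K n → NonEdgeCover []
  iso-K-cover iso u≢v ¬adj = let πu≢πv , ¬adjK = iso-nonadjacent iso u≢v ¬adj in contradiction (adj-K πu≢πv) ¬adjK

  -- The trees are built in `G` itself, so the deleted edges are carried back along the isomorphism,
  -- one pair for each.
  iso-K∖M-cover : ∀ M → G ≅ (K n ∖ M) → ∃[ N ] (length N ≡ ∣ M ∣ᴱ × NonEdgeCover N)
  iso-K∖M-cover M iso = map back (edge-list M) , length-map back (edge-list M) , λ u≢v ¬adj →
      let πu≢πv , ¬adjK∖M = iso-nonadjacent iso u≢v ¬adj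
          adjM = decidable-stable (adj? M _ _) λ ¬adjM → ¬adjK∖M (Equivalence.from T-∧ (adj-K πu≢πv , T-not ¬adjM))
      in Sum.map pull pull (edge-list-cover M adjM)
    where
    open _≅_ iso
    back : V × V → V × V
    back (u , v) = bijection ⟨$⟩ˡ u , bijection ⟨$⟩ˡ v
    T-not : ∀ {b} → ¬ T b → T (not b)
    T-not {false} _ = tt
    T-not {true} ¬t = ¬t tt
    pull : ∀ {u v} → (bijection ⟨$⟩ʳ u , bijection ⟨$⟩ʳ v) ∈ edge-list M → (u , v) ∈ map back (edge-list M)
    pull m = subst (_∈ _) (cong₂ _,_ (inverseˡ bijection) (inverseˡ bijection)) (∈-map⁺ back m)

  edgeless : (E : EdgeSet n) → ∣ E ∣ᴱ ≤ 0 → ∀ {u v} → ¬ Adj E u v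
  edgeless E few a with edge-list E | few | edge-list-cover E a
  ... | [] | _ | inj₁ ()
  ... | [] | _ | inj₂ ()

  complement : EdgeSet n
  complement = edges (K n ∖ edges G)

  complement-spec : ∀ {u v} → Adj complement u v → u ≢ v × ¬ Adj (edges G) u v
  complement-spec {u} {v} a with u ≟ v | Γ.mem u v
  complement-spec () | yes _ | _
  complement-spec () | no _ | true
  ... | no u≢v | false = u≢v , λ ()

  iso-complement : G ≅ (K n ∖ complement)
  iso-complement = record { bijection = id ; adj-cong = same }
    where
    same : ∀ u v → EdgeSet.mem (edges (K n ∖ complement)) u v ≡ Γ.mem u v
    same u v with u ≟ v
    ... | yes refl = sym (Γ.mem-irrefl u)
    ... | no _ = not-involutive (Γ.mem u v)

  iso-K : ∣ complement ∣ᴱ ≤ 0 → G ≅ K n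
  iso-K none = record { bijection = id ; adj-cong = same }
    where
    same : ∀ u v → EdgeSet.mem (edges (K n)) u v ≡ Γ.mem u v
    same u v with u ≟ v | Γ.mem u v in eq | edgeless complement none {u} {v}
    ... | yes refl | _ | _ = trans (sym (Γ.mem-irrefl u)) eq
    ... | no _ | true | _ = refl
    ... | no _ | false | ¬a = contradiction tt ¬a

  module _ {k q p : ℕ} (slack : Slack k q p) (3≤k : 3 ≤ k) (k≤n : k ≤ n) where

    private
      m = (n ∸ k) + q

    ∣elements-∁∣ : ∀ (S : Subset n) → ∣ S ∣ ≡ k → length (elements (∁ S)) + q ≡ m
    ∣elements-∁∣ S ∣S∣ = cong (_+ q) (trans (length-elements (∁ S)) (trans (∣∁p∣≡n∸∣p∣ S) (cong (n ∸_) ∣S∣)))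

    -- Each S of size k carries m trees, so no maximum is below m. Conversely, the count without
    -- missing edges gives jk ≤ mk + p, and p < k turns this into j ≤ m.
    cover⇒λ : ∀ {N} → length N ≤ p → NonEdgeCover N → λ⟨ k ⟩[ G ]≡ m
    cover⇒λ {N} ∣N∣ cover =
      (let S , ∣S∣ , _ = subset-of-size k ⊥ˢ (≤-trans (≤-reflexive (∣⊥∣≡0 n)) z≤n) k≤n in
       S , ∣S∣ , trees ∣S∣ , λ j Tj → s≤s⁻¹ (ℕ.*-cancelʳ-< k j (suc m) (bound ∣S∣ Tj))) ,
      λ j (S , ∣S∣ , _ , max) → max m (trees ∣S∣)
      where
      trees : ∀ {S} → ∣ S ∣ ≡ k → EdgeDisjointTrees G S m
      trees {S} ∣S∣ = subst (EdgeDisjointTrees G S) (∣elements-∁∣ S ∣S∣) (trees-exist slack 3≤k G S ∣S∣ N ∣N∣ cover)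
      bound : ∀ {S j} → ∣ S ∣ ≡ k → EdgeDisjointTrees G S j → j * k < suc m * k
      bound {S} {j} ∣S∣ Tj = ≤-trans (s≤s (≤-trans (m≤m+n (j * k) 0) (trees-bound slack 3≤k G S ∣S∣ Tj [] [] λ ())))
        (≤-trans (≤-reflexive (trans (cong (λ x → suc (x * k + p)) (∣elements-∁∣ S ∣S∣)) (sym (+-suc (m * k) p))))
        (≤-trans (+-monoʳ-≤ (m * k) (≤-trans (n≤1+n _) (slack< slack 3≤k))) (≤-reflexive (+-comm (m * k) k))))

    -- If more than p edges are missing, choose p + 1 of them and let S contain an end of each.
    λ⇒few-missing : λ⟨ k ⟩[ G ]≡ m → ∣ complement ∣ᴱ ≤ p
    -- Decidability of the conclusion permits a proof by contradiction, inside which a maximum for S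
    -- may be assumed. The search for it starts at the empty family of trees, and `bound` keeps it
    -- below m, against minimality.
    λ⇒few-missing (_ , minimal) = decidable-stable (∣ complement ∣ᴱ ≤? p) λ many →
      ¬¬-maximum m 0 ((λ ()) , λ ()) (bound (≰⇒> many)) λ (j , max) →
        <-irrefl refl (≤-trans (bound (≰⇒> many) (proj₁ max)) (minimal j (S , ∣S∣ , max)))
      where
      N = take (suc p) (edge-list complement)
      ends = subset (map proj₁ N)
      S-spec = subset-of-size k ends
        (≤-trans (size-subset (map proj₁ N))
          (≤-trans (≤-reflexive (trans (length-map proj₁ N) (length-take (suc p) (edge-list complement))))
          (≤-trans (ℕ.m⊓n≤m (suc p) _) (≤-trans (n≤1+n _) (slack< slack 3≤k))))) k≤n
      S = proj₁ S-spec
      ∣S∣ = proj₁ (proj₂ S-spec)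
      missing : ∀ {u v} → (u , v) ∈ N → u ≢ v × ¬ Adj (edges G) u v × u ∈ˢ S
      missing m = let u≢v , ¬adj = complement-spec (proj₂ (∈-edge-list⁻ complement (∈-take (suc p) m))) in
        u≢v , ¬adj , proj₂ (proj₂ S-spec) (∈⇒∈-subset (∈-map⁺ proj₁ m))
      uN : Unique (map norm N)
      uN = subst Unique (take-map (suc p) (edge-list complement)) (Unique.take⁺ (suc p) (edge-list-norm complement))
      bound : suc p ≤ ∣ complement ∣ᴱ → ∀ {j} → EdgeDisjointTrees G S j → j < m
      bound many {j} Tj = ℕ.*-cancelʳ-< k j m (ℕ.+-cancelʳ-≤ p (suc (j * k)) (m * k)
        (≤-trans (≤-reflexive (trans (sym (+-suc (j * k) p))
                   (cong (j * k +_) (sym (length-take-≤ (suc p) (edge-list complement) many)))))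
        (≤-trans (trees-bound slack 3≤k G S ∣S∣ Tj N uN missing) (≤-reflexive (cong (λ x → x * k + p) (∣elements-∁∣ S ∣S∣))))))

Shape : ∀ {n} → Graph n → ℕ → Set
Shape {n} G k = (2 ∣ k → G ≅ K n)
  × (¬ (2 ∣ k) → ∃[ M ] (M ⊆ᴱ edges (K n) × ∣ M ∣ᴱ ≤ (k ∸ 1) / 2 × G ≅ (K n ∖ M)))

theorem5 : ∀ (n k : ℕ) (G : Graph n) → Connected G → 3 ≤ k → k ≤ n →
    (λ⟨ k ⟩[ G ]≡ (n ∸ ⌈ k /2⌉))
    ⇔
    ((2 ∣ k → G ≅ K n)
    × (¬ (2 ∣ k) → ∃[ M ] (M ⊆ᴱ edges (K n) × ∣ M ∣ᴱ ≤ (k ∸ 1) / 2 × G ≅ (K n ∖ M))))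
theorem5 n k G _ 3≤k k≤n with slack-∃ k
... | q , p , slack = subst (λ m → (λ⟨ k ⟩[ G ]≡ m) ⇔ Shape G k) (slack-order n slack k≤n) (mk⇔
    (shape slack ∘ λ⇒few-missing G slack 3≤k k≤n)
    (λ rhs → let N , ∣N∣ , cover = cover slack rhs in cover⇒λ G slack 3≤k k≤n ∣N∣ cover))
  where
  half : ∀ q → (q + q) / 2 ≡ q
  half q = trans (cong (_/ 2) (double≡*2 q)) (m*n/n≡m q 2)
  shape : ∀ {k q p} → Slack k q p → ∣ complement G ∣ᴱ ≤ p → Shape G k
  shape (even {q}) few = (λ _ → iso-K G few) , λ 2∤k → contradiction (divides q (double≡*2 q)) 2∤k
  shape (odd {q}) few = (λ 2∣k → contradiction 2∣k (odd-not-even q)) , λ _ →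
    complement G , (λ a → proj₁ (Equivalence.to T-∧ a)) , subst (∣ complement G ∣ᴱ ≤_) (sym (half q)) few , iso-complement G
  cover : ∀ {k q p} → Slack k q p → Shape G k → ∃[ N ] (length N ≤ p × NonEdgeCover G N)
  cover (even {q}) (complete , _) = [] , z≤n , iso-K-cover G (complete (divides q (double≡*2 q)))
  cover (odd {q}) (_ , nearly) with nearly (odd-not-even q)
  ... | M , _ , ∣M∣ , iso with iso-K∖M-cover G M iso
  ...   | N , ∣N∣ , cov = N , ≤-trans (≤-reflexive ∣N∣) (subst (∣ M ∣ᴱ ≤_) (half q) ∣M∣) , cov
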